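{- Let $G$ be a reduced bipartite graph of rank $r\geqslant 6$ and order $n>c(r)=3\cdot 2^{r/2-2}+r/2$, with bipartition $\{X,Y\}$. Then $\min\{|X|,|Y|\}=r/2$.
   Context: All graphs are finite and simple. The rank of a graph $G$ is the rank (over the reals) of its adjacency matrix $A(G)$; for a bipartite graph this rank is always even. For a vertex $v$, $N(v)$ denotes the set of vertices adjacent to $v$. A graph is reduced if it has no isolated vertex and no two distinct vertices $u,v$ with $N(u)=N(v)$. A bipartition $\{X,Y\}$ of $G$ is a partition of $V(G)$ into two independent sets. -}

module Defs where

open import Data.Nat using (ℕ; zero; suc; _+_)
open import Data.Bool using (Bool; true; false; if_then_else_)
open import Data.Fin using (Fin; zero; suc)
open import Data.Product using (Σ; ∃; _×_; _,_)
open import Relation.Binary.PropositionalEquality using (_≡_; _≢_)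
open import Relation.Nullary using (¬_)
open import Data.Nat using (_≤_)
open import Data.Rational using (ℚ; 0ℚ; 1ℚ) renaming (_+_ to _+ℚ_; _*_ to _*ℚ_)

record Graph (n : ℕ) : Set where
  field
    adj   : Fin n → Fin n → Bool
    sym   : ∀ u v → adj u v ≡ adj v u
    irrefl : ∀ v → adj v v ≡ false
open Graph public

Σℚ : (k : ℕ) → (Fin k → ℚ) → ℚ
Σℚ zero    f = 0ℚ
Σℚ (suc k) f = f zero +ℚ Σℚ k (λ i → f (suc i))

count : (k : ℕ) → (Fin k → Bool) → ℕ
count zero    p = 0
count (suc k) p = (if p zero then 1 else 0) + count k (λ i → p (suc i))

adjMatrix : {n : ℕ} → Graph n → Fin n → Fin n → ℚ
adjMatrix G u v = if adj G u v then 1ℚ else 0ℚ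

RowsIndependent : {m n k : ℕ} → (Fin m → Fin n → ℚ) → (Fin k → Fin m) → Set
RowsIndependent {m} {n} {k} M f =
  (c : Fin k → ℚ) →
  (∀ j → Σℚ k (λ i → c i *ℚ M (f i) j) ≡ 0ℚ) →
  ∀ i → c i ≡ 0ℚ

HasRank : {m n : ℕ} → (Fin m → Fin n → ℚ) → ℕ → Set
HasRank {m} M r =
  Σ (Fin r → Fin m) (λ f → RowsIndependent M f) ×
  (∀ (k : ℕ) (f : Fin k → Fin m) → RowsIndependent M f → k ≤ r)

GraphRank : {n : ℕ} → Graph n → ℕ → Set
GraphRank G r = HasRank (adjMatrix G) r

Reduced : {n : ℕ} → Graph n → Set
Reduced {n} G =
  (∀ v → ∃ λ u → adj G v u ≡ true) ×
  (∀ u v → (∀ w → adj G u w ≡ adj G v w) → u ≡ v)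

-- a bipartition {X,Y}: X = vertices coloured false, Y = vertices coloured true;
-- both classes independent, i.e. adjacent vertices get different colours
IsBipartition : {n : ℕ} → Graph n → (Fin n → Bool) → Set
IsBipartition G col = ∀ u v → adj G u v ≡ true → col u ≢ col v

Bipartite : {n : ℕ} → Graph n → Set
Bipartite {n} G = Σ (Fin n → Bool) (IsBipartition G)

sizeX sizeY : {n : ℕ} → (Fin n → Bool) → ℕ
sizeX {n} col = count n (λ v → if col v then false else true)
sizeY {n} col = count n col

{-# OPTIONS --safe #-}

-- Adjoin a zero row and a zero column to the biadjacency matrix: this gives a 0/1 matrix of
-- rank d = r/2 with P = |X| + 1 distinct rows and Q = |Y| + 1 distinct columns, and it suffices that
-- P, Q ≥ d + 2 implies P + Q ≤ 3·2^(d-2) + d + 2. By transposition let Q ≤ P, and induct on d.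
--
-- Fix a basis of the columns, a basis column c₀, and let T be the set of τ columns whose c₀-coordinate
-- is nonzero. Deleting T drops the rank to d - 1 and identifies rows only in pairs; let m be the
-- number of pairs, so that the induction hypothesis concerns P′ = P - m rows and Q′ = Q - τ columns.
-- The upper rows of all pairs coincide on T, so if T has rank s then m ≤ 2^(d-s), while τ ≤ 2^s - 1.
-- If Q′ ≥ d + 1, the bound follows from the induction hypothesis: for s ≤ 1 because τ ≤ 1, for
-- s ≥ d - 1 because m ≤ 2 and Q ≤ P, and otherwise because 2^s + 2^(d-s) ≤ 2^(d-2) + 4.
--
-- A family of k ≥ s + 2 columns of rank s < d always yields a choice of basis with Q′ ≥ d + 1. If this
-- applies neither to T (with the zero column) nor to the set of columns where two given rows agree,
-- then either τ ≤ s, or s = d, m ≤ 1 and (as any three rows agree pairwise on at least Q + 2 columns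
-- in total) Q ≤ 3d - 2; the bound is then immediate from P′ ≤ 2^(d-1).
module Submission where

open import Defs renaming (sym to adj-sym)
open import Data.Nat as ℕ using (ℕ; zero; suc; _+_; _*_; _∸_; _^_; _≤_; _<_; _⊓_; z≤n; s≤s)
import Data.Nat.Properties as ℕ
open import Data.Nat.DivMod using (_/_; m*n/n≡m; /-monoˡ-≤)
open import Data.Nat.Tactic.RingSolver using () renaming (solve to ring)
open import Data.Bool as Bool using (Bool; true; false; not; if_then_else_)
open import Data.Empty using (⊥; ⊥-elim)
open import Data.Fin as Fin using (Fin; zero; suc; _↑ˡ_; _↑ʳ_; splitAt; punchIn; punchOut)
import Data.Fin.Properties as Fin
open import Data.List using (_∷_; [])
open import Data.Product using (Σ; ∃; _×_; _,_; proj₁; proj₂)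
open import Data.Rational using (ℚ; 0ℚ; 1ℚ; 1/_; ≢-nonZero) renaming (_+_ to _+ℚ_; _*_ to _*ℚ_; -_ to -ℚ_; _-_ to _-ℚ_)
import Data.Rational.Properties as ℚ
open import Data.Rational.Solver using (module +-*-Solver)
open import Data.Sum using (_⊎_; inj₁; inj₂; [_,_]′)
open import Function using (_∘_)
open import Function.Definitions using (Injective)
open import Relation.Nullary using (¬_; Dec; yes; no; does; contradiction; _×-dec_)
open import Relation.Nullary.Decidable using (dec-true; dec-false)
open import Relation.Binary.PropositionalEquality using (_≡_; _≢_; refl; sym; trans; cong; cong₂; subst; module ≡-Reasoning)

-- Linear algebra over ℚ

Σ-cong : ∀ k {f g : Fin k → ℚ} → (∀ i → f i ≡ g i) → Σℚ k f ≡ Σℚ k g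
Σ-cong zero    e = refl
Σ-cong (suc k) e = cong₂ _+ℚ_ (e zero) (Σ-cong k (e ∘ suc))

Σ-zero : ∀ k {f : Fin k → ℚ} → (∀ i → f i ≡ 0ℚ) → Σℚ k f ≡ 0ℚ
Σ-zero zero    e = refl
Σ-zero (suc k) e = cong₂ _+ℚ_ (e zero) (Σ-zero k (e ∘ suc))

Σ-+ : ∀ k (f g : Fin k → ℚ) → Σℚ k (λ i → f i +ℚ g i) ≡ Σℚ k f +ℚ Σℚ k g
Σ-+ zero    f g = refl
Σ-+ (suc k) f g = trans (cong (f zero +ℚ g zero +ℚ_) (Σ-+ k (f ∘ suc) (g ∘ suc)))
  (solve 4 (λ a b c d → a :+ b :+ (c :+ d) := a :+ c :+ (b :+ d)) refl
    (f zero) (g zero) (Σℚ k (f ∘ suc)) (Σℚ k (g ∘ suc)))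
  where open +-*-Solver using (solve; _:=_; _:+_; _:*_; _:-_; :-_; con)

Σ-*ˡ : ∀ k a (f : Fin k → ℚ) → Σℚ k (λ i → a *ℚ f i) ≡ a *ℚ Σℚ k f
Σ-*ˡ zero    a f = sym (ℚ.*-zeroʳ a)
Σ-*ˡ (suc k) a f = trans (cong (a *ℚ f zero +ℚ_) (Σ-*ˡ k a (f ∘ suc))) (sym (ℚ.*-distribˡ-+ a _ _))

Σ-*ʳ : ∀ k a (f : Fin k → ℚ) → Σℚ k (λ i → f i *ℚ a) ≡ Σℚ k f *ℚ a
Σ-*ʳ k a f = trans (Σ-cong k (λ i → ℚ.*-comm (f i) a)) (trans (Σ-*ˡ k a f) (ℚ.*-comm a _))

Σ-swap : ∀ k l (f : Fin k → Fin l → ℚ) →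
  Σℚ k (λ i → Σℚ l (f i)) ≡ Σℚ l (λ j → Σℚ k (λ i → f i j))
Σ-swap zero    l f = sym (Σ-zero l (λ _ → refl))
Σ-swap (suc k) l f = trans (cong (Σℚ l (f zero) +ℚ_) (Σ-swap k l (f ∘ suc))) (sym (Σ-+ l _ _))

δ : ∀ {k} → Fin k → Fin k → ℚ
δ zero    zero    = 1ℚ
δ zero    (suc _) = 0ℚ
δ (suc _) zero    = 0ℚ
δ (suc i) (suc j) = δ i j

δ-refl : ∀ {k} (i : Fin k) → δ i i ≡ 1ℚ
δ-refl zero    = refl
δ-refl (suc i) = δ-refl i

δ-sym : ∀ {k} (i j : Fin k) → δ i j ≡ δ j i
δ-sym zero    zero    = refl
δ-sym zero    (suc j) = refl
δ-sym (suc i) zero    = refl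
δ-sym (suc i) (suc j) = δ-sym i j

δ-≢ : ∀ {k} {i j : Fin k} → i ≢ j → δ i j ≡ 0ℚ
δ-≢ {i = zero}  {zero}  n = contradiction refl n
δ-≢ {i = zero}  {suc j} n = refl
δ-≢ {i = suc i} {zero}  n = refl
δ-≢ {i = suc i} {suc j} n = δ-≢ (n ∘ cong suc)

Σ-δ : ∀ {k} (j : Fin k) (f : Fin k → ℚ) → Σℚ k (λ i → f i *ℚ δ i j) ≡ f j
Σ-δ {suc k} zero f =
  trans (cong₂ _+ℚ_ (ℚ.*-identityʳ (f zero)) (Σ-zero k (λ i → ℚ.*-zeroʳ (f (suc i))))) (ℚ.+-identityʳ _)
Σ-δ {suc k} (suc j) f =
  trans (cong₂ _+ℚ_ (ℚ.*-zeroʳ (f zero)) (Σ-δ j (f ∘ suc))) (ℚ.+-identityˡ _)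

dot : ∀ {p} → (Fin p → ℚ) → (Fin p → ℚ) → ℚ
dot {p} φ w = Σℚ p (λ x → φ x *ℚ w x)

comb : ∀ {k p} → (Fin k → ℚ) → (Fin k → Fin p → ℚ) → Fin p → ℚ
comb {k} c w x = Σℚ k (λ i → c i *ℚ w i x)

dot-cong : ∀ {p} (φ : Fin p → ℚ) {u w : Fin p → ℚ} → (∀ x → u x ≡ w x) → dot φ u ≡ dot φ w
dot-cong φ e = Σ-cong _ (λ x → cong (φ x *ℚ_) (e x))

dot-zero : ∀ {p} (φ : Fin p → ℚ) {u : Fin p → ℚ} → (∀ x → u x ≡ 0ℚ) → dot φ u ≡ 0ℚ
dot-zero φ e = Σ-zero _ (λ x → trans (cong (φ x *ℚ_) (e x)) (ℚ.*-zeroʳ (φ x)))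

dot-comb : ∀ {k p} (φ : Fin p → ℚ) (c : Fin k → ℚ) (w : Fin k → Fin p → ℚ) →
  dot φ (comb c w) ≡ Σℚ k (λ i → c i *ℚ dot φ (w i))
dot-comb {k} {p} φ c w = begin
  Σℚ p (λ x → φ x *ℚ Σℚ k (λ i → c i *ℚ w i x))
    ≡⟨ Σ-cong p (λ x → sym (Σ-*ˡ k (φ x) _)) ⟩
  Σℚ p (λ x → Σℚ k (λ i → φ x *ℚ (c i *ℚ w i x)))
    ≡⟨ Σ-swap p k _ ⟩
  Σℚ k (λ i → Σℚ p (λ x → φ x *ℚ (c i *ℚ w i x)))
    ≡⟨ Σ-cong k (λ i → Σ-cong p (λ x →
         solve 3 (λ a b d → a :* (b :* d) := b :* (a :* d)) refl (φ x) (c i) (w i x))) ⟩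
  Σℚ k (λ i → Σℚ p (λ x → c i *ℚ (φ x *ℚ w i x)))
    ≡⟨ Σ-cong k (λ i → Σ-*ˡ p (c i) _) ⟩
  Σℚ k (λ i → c i *ℚ dot φ (w i)) ∎
  where open ≡-Reasoning
        open +-*-Solver using (solve; _:=_; _:+_; _:*_; _:-_; :-_; con)

comb-dot : ∀ {k p} (c : Fin k → ℚ) (φ : Fin k → Fin p → ℚ) (w : Fin p → ℚ) →
  dot (comb c φ) w ≡ Σℚ k (λ i → c i *ℚ dot (φ i) w)
comb-dot {k} {p} c φ w = begin
  Σℚ p (λ x → comb c φ x *ℚ w x)
    ≡⟨ Σ-cong p (λ x → ℚ.*-comm (comb c φ x) (w x)) ⟩
  dot w (comb c φ)
    ≡⟨ dot-comb w c φ ⟩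
  Σℚ k (λ i → c i *ℚ dot w (φ i))
    ≡⟨ Σ-cong k (λ i → cong (c i *ℚ_) (Σ-cong p (λ x → ℚ.*-comm (w x) (φ i x)))) ⟩
  Σℚ k (λ i → c i *ℚ dot (φ i) w) ∎
  where open ≡-Reasoning

p-q≡0⇒p≡q : ∀ a b → a -ℚ b ≡ 0ℚ → a ≡ b
p-q≡0⇒p≡q a b e = trans (solve 2 (λ a b → a := (a :- b) :+ b) refl a b)
  (trans (cong (_+ℚ b) e) (ℚ.+-identityˡ b))
  where open +-*-Solver using (solve; _:=_; _:+_; _:*_; _:-_; :-_; con)

Independent : ∀ {k p} → (Fin k → Fin p → ℚ) → Set
Independent {k} u = (c : Fin k → ℚ) → (∀ x → comb c u x ≡ 0ℚ) → ∀ i → c i ≡ 0ℚ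

-- Gaussian elimination on the first vector. If it is zero, it is a relation by itself; otherwise
-- multiples of it clear a coordinate `b₀` from the other vectors, and induction applies to their
-- remaining coordinates.
kernel : ∀ l {k} → l < k → (A : Fin k → Fin l → ℚ) →
  ∃ λ c → (∃ λ i → c i ≢ 0ℚ) × (∀ b → comb c A b ≡ 0ℚ)
kernel zero {suc k} _ A = (λ _ → 1ℚ) , (zero , λ ()) , λ ()
kernel (suc l) {suc k} (s≤s l<k) A with Fin.all? (λ b → A zero b ℚ.≟ 0ℚ)
... | yes z = (λ i → δ i zero) , (zero , λ ()) , λ b →
  trans (Σ-cong (suc k) (λ i → ℚ.*-comm (δ i zero) (A i b)))
        (trans (Σ-δ zero (λ i → A i b)) (z b))
... | no nz with Fin.¬∀⟶∃¬ (suc l) _ (λ b → A zero b ℚ.≟ 0ℚ) nz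
... | b₀ , a≢0 = c , (suc (proj₁ (proj₁ (proj₂ ih))) , proj₂ (proj₁ (proj₂ ih))) , vanish
  where
  instance _ = ≢-nonZero a≢0
  a = A zero b₀
  A′ : Fin k → Fin l → ℚ
  A′ i b = A (suc i) (punchIn b₀ b) -ℚ A (suc i) b₀ *ℚ (1/ a *ℚ A zero (punchIn b₀ b))
  ih = kernel l l<k A′
  c′ = proj₁ ih
  S = Σℚ k (λ i → c′ i *ℚ A (suc i) b₀)
  c : Fin (suc k) → ℚ
  -- This coefficient is the one that makes the combination vanish at the pivot coordinate `b₀`.
  c zero    = -ℚ (S *ℚ 1/ a)
  c (suc i) = c′ i
  open +-*-Solver using (solve; _:=_; _:+_; _:*_; _:-_; :-_; con)
  open ≡-Reasoning
  atPivot : comb c A b₀ ≡ 0ℚ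
  atPivot = begin
    -ℚ (S *ℚ 1/ a) *ℚ a +ℚ S
      ≡⟨ solve 3 (λ s i a → (:- (s :* i)) :* a :+ s := s :- s :* (i :* a)) refl S (1/ a) a ⟩
    S -ℚ S *ℚ (1/ a *ℚ a)
      ≡⟨ cong (λ z → S -ℚ S *ℚ z) (ℚ.*-inverseˡ a) ⟩
    S -ℚ S *ℚ 1ℚ
      ≡⟨ solve 1 (λ s → s :- s :* con 1ℚ := con 0ℚ) refl S ⟩
    0ℚ ∎
  elsewhere : ∀ b → comb c A (punchIn b₀ b) ≡ 0ℚ
  elsewhere b = begin
    -ℚ (S *ℚ 1/ a) *ℚ y +ℚ X
      ≡⟨ solve 4 (λ s i y x → (:- (s :* i)) :* y :+ x := x :+ s :* (:- (i :* y))) refl S (1/ a) y X ⟩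
    X +ℚ S *ℚ z
      ≡⟨ cong (X +ℚ_) (sym (Σ-*ʳ k z _)) ⟩
    X +ℚ Σℚ k (λ i → c′ i *ℚ A (suc i) b₀ *ℚ z)
      ≡⟨ sym (Σ-+ k _ _) ⟩
    Σℚ k (λ i → c′ i *ℚ A (suc i) (punchIn b₀ b) +ℚ c′ i *ℚ A (suc i) b₀ *ℚ z)
      ≡⟨ Σ-cong k (λ i → solve 4 (λ c x w u → c :* x :+ c :* w :* (:- u) := c :* (x :- w :* u)) refl
           (c′ i) (A (suc i) (punchIn b₀ b)) (A (suc i) b₀) (1/ a *ℚ y)) ⟩
    comb c′ A′ b
      ≡⟨ proj₂ (proj₂ ih) b ⟩
    0ℚ ∎
    where
    y = A zero (punchIn b₀ b)
    z = -ℚ (1/ a *ℚ y)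
    X = Σℚ k (λ i → c′ i *ℚ A (suc i) (punchIn b₀ b))
  vanish : ∀ b → comb c A b ≡ 0ℚ
  vanish b with b₀ Fin.≟ b
  ... | yes refl = atPivot
  ... | no b₀≢b = subst (λ b → comb c A b ≡ 0ℚ) (Fin.punchIn-punchOut b₀≢b) (elsewhere (punchOut b₀≢b))

comb-comb : ∀ {k l p} (c : Fin k → ℚ) (L : Fin k → Fin l → ℚ) (w : Fin l → Fin p → ℚ) x →
  comb c (λ i → comb (L i) w) x ≡ comb (comb c L) w x
comb-comb {k} {l} c L w x = begin
  Σℚ k (λ i → c i *ℚ Σℚ l (λ b → L i b *ℚ w b x))
    ≡⟨ Σ-cong k (λ i → sym (Σ-*ˡ l (c i) _)) ⟩
  Σℚ k (λ i → Σℚ l (λ b → c i *ℚ (L i b *ℚ w b x)))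
    ≡⟨ Σ-swap k l _ ⟩
  Σℚ l (λ b → Σℚ k (λ i → c i *ℚ (L i b *ℚ w b x)))
    ≡⟨ Σ-cong l (λ b → trans (Σ-cong k (λ i → sym (ℚ.*-assoc (c i) (L i b) (w b x)))) (Σ-*ʳ k (w b x) _)) ⟩
  Σℚ l (λ b → comb c L b *ℚ w b x) ∎
  where open ≡-Reasoning

-- If `k > l`, the coefficient rows `L` satisfy a nontrivial relation, which `u` inherits. All
-- comparisons of ranks below go through this form of the exchange lemma.
independent⇒≤ : ∀ {k l p} (u : Fin k → Fin p → ℚ) (L : Fin k → Fin l → ℚ) (w : Fin l → Fin p → ℚ) →
  Independent u → (∀ i x → u i x ≡ comb (L i) w x) → k ≤ l
independent⇒≤ {k} {l} u L w ind sp with k ℕ.≤? l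
... | yes k≤l = k≤l
... | no k≰l = let (c , (i , ci≢0) , z) = kernel l (ℕ.≰⇒> k≰l) L in
  contradiction
    (ind c (λ x → trans (Σ-cong k (λ i → cong (c i *ℚ_) (sp i x)))
      (trans (comb-comb c L w x)
        (Σ-zero l (λ b → trans (cong (_*ℚ w b x) (z b)) (ℚ.*-zeroˡ (w b x)))))) i)
    ci≢0

-- Independence of a subfamily, witnessed by functionals biorthogonal to it.
record Dual {q p : ℕ} (v : Fin q → Fin p → ℚ) (s : ℕ) : Set where
  field
    ix   : Fin s → Fin q
    φ    : Fin s → Fin p → ℚ
    dual : ∀ i j → dot (φ i) (v (ix j)) ≡ δ i j

  -- These are the coordinates of `v j` as soon as the subfamily spans. Being values of fixed
  -- functionals, they make sense before that too.
  coef : Fin s → Fin q → ℚ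
  coef i j = dot (φ i) (v j)

  Spans : Set
  Spans = ∀ j x → v j x ≡ comb (λ i → coef i j) (v ∘ ix) x

  independent : Independent (v ∘ ix)
  independent c z i = begin
    c i                                          ≡⟨ sym (Σ-δ i c) ⟩
    Σℚ s (λ j → c j *ℚ δ j i)                    ≡⟨ Σ-cong s (λ j → cong (c j *ℚ_) (trans (δ-sym j i) (sym (dual i j)))) ⟩
    Σℚ s (λ j → c j *ℚ dot (φ i) (v (ix j)))     ≡⟨ sym (dot-comb (φ i) c (v ∘ ix)) ⟩
    dot (φ i) (comb c (v ∘ ix))                  ≡⟨ dot-zero (φ i) z ⟩
    0ℚ                                           ∎
    where open ≡-Reasoning

  ix-injective : ∀ {i j} → ix i ≡ ix j → i ≡ j
  ix-injective {i} {j} e with i Fin.≟ j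
  ... | yes i≡j = i≡j
  ... | no i≢j = contradiction
    (trans (sym (δ-refl i)) (trans (sym (dual i i)) (trans (cong (coef i) e) (trans (dual i j) (δ-≢ i≢j)))))
    λ ()

open Dual public

record Basis {q p : ℕ} (v : Fin q → Fin p → ℚ) (s : ℕ) : Set where
  field
    base  : Dual v s
    spans : Spans base

open Basis public

module _ {q p : ℕ} {v : Fin q → Fin p → ℚ} where

  -- The new functional is evaluation at a coordinate x where v j differs from
  -- its projection, corrected to vanish on the old vectors.
  adjoin : ∀ {s} (D : Dual v s) j x → v j x ≢ comb (λ i → coef D i j) (v ∘ ix D) x →
    Σ (Dual v (suc s)) λ D′ → ∀ i → ix D′ (suc i) ≡ ix D i
  adjoin {s} D j x neq = record { ix = ix′ ; φ = φ′ ; dual = dual′ } , λ _ → refl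
    where
    open +-*-Solver using (solve; _:=_; _:+_; _:*_; _:-_; :-_; con)
    open ≡-Reasoning
    proj = λ k → comb (λ i → coef D i k) (v ∘ ix D) x
    ρ = v j x -ℚ proj j
    instance _ = ≢-nonZero {ρ} (λ e → neq (p-q≡0⇒p≡q _ _ e))
    ix′ : Fin (suc s) → Fin q
    ix′ zero    = j
    ix′ (suc i) = ix D i
    a : Fin s → ℚ
    a i = v (ix D i) x
    ψ : Fin p → ℚ
    ψ y = 1/ ρ *ℚ (δ y x -ℚ comb a (φ D) y)
    dot-ψ : ∀ w → dot ψ w ≡ 1/ ρ *ℚ (w x -ℚ Σℚ s (λ i → a i *ℚ dot (φ D i) w))
    dot-ψ w = begin
      Σℚ p (λ y → 1/ ρ *ℚ (δ y x -ℚ comb a (φ D) y) *ℚ w y)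
        ≡⟨ Σ-cong p (λ y → solve 4 (λ r d c w → r :* (d :- c) :* w := r :* (w :* d :+ (con (-ℚ 1ℚ)) :* (c :* w))) refl
             (1/ ρ) (δ y x) (comb a (φ D) y) (w y)) ⟩
      Σℚ p (λ y → 1/ ρ *ℚ (w y *ℚ δ y x +ℚ (-ℚ 1ℚ) *ℚ (comb a (φ D) y *ℚ w y)))
        ≡⟨ Σ-*ˡ p (1/ ρ) _ ⟩
      1/ ρ *ℚ Σℚ p (λ y → w y *ℚ δ y x +ℚ (-ℚ 1ℚ) *ℚ (comb a (φ D) y *ℚ w y))
        ≡⟨ cong (1/ ρ *ℚ_) (Σ-+ p _ _) ⟩
      1/ ρ *ℚ (Σℚ p (λ y → w y *ℚ δ y x) +ℚ Σℚ p (λ y → (-ℚ 1ℚ) *ℚ (comb a (φ D) y *ℚ w y)))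
        ≡⟨ cong (1/ ρ *ℚ_) (cong₂ _+ℚ_ (Σ-δ x w) (trans (Σ-*ˡ p (-ℚ 1ℚ) _) (cong ((-ℚ 1ℚ) *ℚ_) (comb-dot a (φ D) w)))) ⟩
      1/ ρ *ℚ (w x +ℚ (-ℚ 1ℚ) *ℚ E)
        ≡⟨ solve 3 (λ r w e → r :* (w :+ con (-ℚ 1ℚ) :* e) := r :* (w :- e)) refl (1/ ρ) (w x) E ⟩
      1/ ρ *ℚ (w x -ℚ E) ∎
      where E = Σℚ s (λ i → a i *ℚ dot (φ D i) w)
    ψ-new : dot ψ (v j) ≡ 1ℚ
    ψ-new = begin
      dot ψ (v j)
        ≡⟨ dot-ψ (v j) ⟩
      1/ ρ *ℚ (v j x -ℚ Σℚ s (λ i → a i *ℚ coef D i j))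
        ≡⟨ cong (λ z → 1/ ρ *ℚ (v j x -ℚ z)) (Σ-cong s (λ i → ℚ.*-comm (a i) (coef D i j))) ⟩
      1/ ρ *ℚ ρ
        ≡⟨ ℚ.*-inverseˡ ρ ⟩
      1ℚ ∎
    ψ-old : ∀ k → dot ψ (v (ix D k)) ≡ 0ℚ
    ψ-old k = begin
      dot ψ (v (ix D k))
        ≡⟨ dot-ψ (v (ix D k)) ⟩
      1/ ρ *ℚ (a k -ℚ Σℚ s (λ i → a i *ℚ coef D i (ix D k)))
        ≡⟨ cong (λ z → 1/ ρ *ℚ (a k -ℚ z)) (trans (Σ-cong s (λ i → cong (a i *ℚ_) (dual D i k))) (Σ-δ k a)) ⟩
      1/ ρ *ℚ (a k -ℚ a k)
        ≡⟨ solve 2 (λ r a → r :* (a :- a) := con 0ℚ) refl (1/ ρ) (a k) ⟩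
      0ℚ ∎
    φ′ : Fin (suc s) → Fin p → ℚ
    φ′ zero    = ψ
    -- The old functionals are corrected in turn, so that they vanish on the new vector, where `ψ`
    -- is 1.
    φ′ (suc i) y = φ D i y -ℚ coef D i j *ℚ ψ y
    dot-φ′ : ∀ i w → dot (φ′ (suc i)) w ≡ dot (φ D i) w -ℚ coef D i j *ℚ dot ψ w
    dot-φ′ i w = begin
      Σℚ p (λ y → (φ D i y -ℚ c *ℚ ψ y) *ℚ w y)
        ≡⟨ Σ-cong p (λ y → solve 4 (λ f c s w → (f :- c :* s) :* w := f :* w :+ (:- c) :* (s :* w)) refl (φ D i y) c (ψ y) (w y)) ⟩
      Σℚ p (λ y → φ D i y *ℚ w y +ℚ (-ℚ c) *ℚ (ψ y *ℚ w y))
        ≡⟨ Σ-+ p _ _ ⟩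
      dot (φ D i) w +ℚ Σℚ p (λ y → (-ℚ c) *ℚ (ψ y *ℚ w y))
        ≡⟨ cong (dot (φ D i) w +ℚ_) (Σ-*ˡ p (-ℚ c) _) ⟩
      dot (φ D i) w +ℚ (-ℚ c) *ℚ dot ψ w
        ≡⟨ solve 3 (λ f c s → f :+ (:- c) :* s := f :- c :* s) refl (dot (φ D i) w) c (dot ψ w) ⟩
      dot (φ D i) w -ℚ c *ℚ dot ψ w ∎
      where c = coef D i j
    dual′ : ∀ i k → dot (φ′ i) (v (ix′ k)) ≡ δ i k
    dual′ zero    zero    = ψ-new
    dual′ zero    (suc k) = ψ-old k
    dual′ (suc i) zero    = begin
      dot (φ′ (suc i)) (v j)            ≡⟨ dot-φ′ i (v j) ⟩
      c -ℚ c *ℚ dot ψ (v j)             ≡⟨ cong (λ z → c -ℚ c *ℚ z) ψ-new ⟩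
      c -ℚ c *ℚ 1ℚ                      ≡⟨ solve 1 (λ c → c :- c :* con 1ℚ := con 0ℚ) refl c ⟩
      0ℚ                                ∎
      where c = coef D i j
    dual′ (suc i) (suc k) = begin
      dot (φ′ (suc i)) (v (ix D k))                 ≡⟨ dot-φ′ i (v (ix D k)) ⟩
      coef D i (ix D k) -ℚ c *ℚ dot ψ (v (ix D k))  ≡⟨ cong₂ (λ y z → y -ℚ c *ℚ z) (dual D i k) (ψ-old k) ⟩
      δ i k -ℚ c *ℚ 0ℚ                              ≡⟨ solve 2 (λ d c → d :- c :* con 0ℚ := d) refl (δ i k) c ⟩
      δ i k                                         ∎
      where c = coef D i j

  spans? : ∀ {s} (D : Dual v s) →
    Spans D ⊎ ∃ λ j → ∃ λ x → v j x ≢ comb (λ i → coef D i j) (v ∘ ix D) x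
  spans? D with Fin.all? (λ j → Fin.all? (λ x → v j x ℚ.≟ comb (λ i → coef D i j) (v ∘ ix D) x))
  ... | yes sp = inj₁ sp
  ... | no ¬sp =
    let (j , ¬sp-j) = Fin.¬∀⟶∃¬ q _ (λ j → Fin.all? (λ x → v j x ℚ.≟ comb (λ i → coef D i j) (v ∘ ix D) x)) ¬sp
    in inj₂ (j , Fin.¬∀⟶∃¬ p _ (λ x → v j x ℚ.≟ comb (λ i → coef D i j) (v ∘ ix D) x) ¬sp-j)

  dual-size≤dim : ∀ {s} → Dual v s → s ≤ p
  dual-size≤dim D = independent⇒≤ (v ∘ ix D) (v ∘ ix D) δ (independent D)
    (λ i x → sym (Σ-δ x (v (ix D i))))

  -- New vectors are put in front, so the given ones keep their order as the last `s` positions.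
  -- Later arguments read off from the position whether a basis vector is old or new.
  extend : ∀ {s} (D : Dual v s) →
    ∃ λ t → Σ (Basis v (t ℕ.+ s)) λ B → ∀ i → ix (base B) (t ↑ʳ i) ≡ ix D i
  -- Each round adds a vector to an independent family in dimension `p`, so `suc p` rounds cannot
  -- all be used up.
  extend {s} D = go (suc p) 0 D (λ _ → refl) (ℕ.m≤n⇒m≤o+n s ℕ.≤-refl)
    where
    go : ∀ fuel t (E : Dual v (t ℕ.+ s)) → (∀ i → ix E (t ↑ʳ i) ≡ ix D i) → p < t ℕ.+ s ℕ.+ fuel →
      ∃ λ t → Σ (Basis v (t ℕ.+ s)) λ B → ∀ i → ix (base B) (t ↑ʳ i) ≡ ix D i
    go zero t E e lt = contradiction (dual-size≤dim E) (ℕ.<⇒≱ (subst (p <_) (ℕ.+-identityʳ _) lt))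
    go (suc fuel) t E e lt with spans? E
    ... | inj₁ sp = t , record { base = E ; spans = sp } , e
    ... | inj₂ (j , x , neq) =
      let (E′ , e′) = adjoin E j x neq in
      go fuel (suc t) E′ (λ i → trans (e′ (t ↑ʳ i)) (e i)) (subst (p <_) (ℕ.+-suc _ fuel) lt)

  dual≤basis : ∀ {s d} → Dual v s → Basis v d → s ≤ d
  dual≤basis D B = independent⇒≤ (v ∘ ix D) (λ i b → coef (base B) b (ix D i)) (v ∘ ix (base B))
    (independent D) (λ i → spans B (ix D i))

  basis : ∃ λ s → Basis v s
  basis with extend {0} (record { ix = λ () ; φ = λ () ; dual = λ () })
  ... | t , B , _ = t ℕ.+ 0 , B

-- A basis of the columns factors the matrix through dimension `d`. Read the other way, the
-- factorization writes every row as a combination of the `d` rows of coordinates.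
transpose-≤ : ∀ {q p d e} {v : Fin q → Fin p → ℚ} → Basis v d → Dual (λ x j → v j x) e → e ≤ d
transpose-≤ {v = v} B D =
  independent⇒≤ _ (λ i b → v (ix (base B) b) (ix D i)) (coef (base B)) (independent D)
    (λ i j → trans (spans B j (ix D i)) (Σ-cong _ (λ b → ℚ.*-comm (coef (base B) b j) (v (ix (base B) b) (ix D i)))))

transpose-basis : ∀ {q p d} {v : Fin q → Fin p → ℚ} → Basis v d → Basis (λ x j → v j x) d
transpose-basis {v = v} B with basis {v = λ x j → v j x}
... | e , B′ = subst (Basis _) (ℕ.≤-antisym (transpose-≤ B (base B′)) (transpose-≤ B′ (base B))) B′

-- Counting, and 0/1 matrices

does-true : ∀ {A : Set} (a? : Dec A) → does a? ≡ true → A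
does-true (yes a) _ = a

does-false : ∀ {A : Set} (a? : Dec A) → not (does a?) ≡ true → ¬ A
does-false (no ¬a) _ = ¬a

record Enumeration {n : ℕ} (p : Fin n → Bool) (k : ℕ) : Set where
  field
    elem      : Fin k → Fin n
    injective : ∀ {i j} → elem i ≡ elem j → i ≡ j
    sound     : ∀ i → p (elem i) ≡ true
    index     : ∀ j → p j ≡ true → Fin k
    elem-index : ∀ j (h : p j ≡ true) → elem (index j h) ≡ j

open Enumeration

enumerate : ∀ {n} (p : Fin n → Bool) → Enumeration p (count n p)
enumerate {zero} p = record
  { elem = λ () ; injective = λ {} ; sound = λ () ; index = λ () ; elem-index = λ () }
enumerate {suc n} p with p zero in p0
... | true = record
  { elem = f ; injective = inj ; sound = snd ; index = idx ; elem-index = ei }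
  where
  E = enumerate (p ∘ suc)
  f : Fin (suc (count n (p ∘ suc))) → Fin (suc n)
  f zero    = zero
  f (suc i) = suc (elem E i)
  inj : ∀ {i j} → f i ≡ f j → i ≡ j
  inj {zero}  {zero}  _ = refl
  inj {suc i} {suc j} e = cong suc (injective E (Fin.suc-injective e))
  snd : ∀ i → p (f i) ≡ true
  snd zero    = p0
  snd (suc i) = sound E i
  idx : ∀ j → p j ≡ true → Fin (suc (count n (p ∘ suc)))
  idx zero    _ = zero
  idx (suc j) h = suc (index E j h)
  ei : ∀ j h → f (idx j h) ≡ j
  ei zero    h = refl
  ei (suc j) h = cong suc (elem-index E j h)
... | false = record
  { elem = suc ∘ elem E ; injective = injective E ∘ Fin.suc-injective ; sound = sound E
  ; index = idx ; elem-index = ei }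
  where
  E = enumerate (p ∘ suc)
  idx : ∀ j → p j ≡ true → Fin (count n (p ∘ suc))
  idx zero    h = contradiction (trans (sym p0) h) λ ()
  idx (suc j) h = index E j h
  ei : ∀ j h → suc (elem E (idx j h)) ≡ j
  ei zero    h = contradiction (trans (sym p0) h) λ ()
  ei (suc j) h = cong suc (elem-index E j h)

count-complement : ∀ n (p q : Fin n → Bool) → (∀ i → q i ≡ not (p i)) → count n p + count n q ≡ n
count-complement zero    p q c = refl
count-complement (suc n) p q c with p zero | q zero | c zero
... | true  | .false | refl = cong suc (count-complement n (p ∘ suc) (q ∘ suc) (c ∘ suc))
... | false | .true  | refl =
  trans (ℕ.+-suc _ _) (cong suc (count-complement n (p ∘ suc) (q ∘ suc) (c ∘ suc)))

injection⇒≤count : ∀ {k n} (p : Fin n → Bool) (f : Fin k → Fin n) →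
  Injective _≡_ _≡_ f → (∀ i → p (f i) ≡ true) → k ≤ count n p
injection⇒≤count p f inj h = Fin.injective⇒≤ {f = λ i → index E (f i) (h i)}
  (λ {i} {j} e → inj (trans (sym (elem-index E (f i) (h i))) (trans (cong (elem E) e) (elem-index E (f j) (h j)))))
  where E = enumerate p

bit : Bool → Fin 2
bit false = zero
bit true  = suc zero

bit-injective : ∀ {a b} → bit a ≡ bit b → a ≡ b
bit-injective {false} {false} _ = refl
bit-injective {true}  {true}  _ = refl

separated⇒≤2^ : ∀ {k s} (f : Fin k → Fin s → Bool) → (∀ i j → (∀ x → f i x ≡ f j x) → i ≡ j) → k ≤ 2 ^ s
separated⇒≤2^ {k} {s} f sep = Fin.injective⇒≤ {f = λ i → Fin.funToFin {s} (bit ∘ f i)}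
  (λ {i} {j} e → sep i j (λ x → bit-injective
    (trans (sym (Fin.finToFun-funToFin (bit ∘ f i) x))
      (trans (cong (λ z → Fin.finToFun {2} {s} z x) e) (Fin.finToFun-funToFin (bit ∘ f j) x)))))

merge-injective : ∀ {m n q} (f : Fin m → Fin q) (g : Fin n → Fin q) →
  Injective _≡_ _≡_ f → Injective _≡_ _≡_ g → (∀ i j → f i ≢ g j) →
  Injective _≡_ _≡_ ([ f , g ]′ ∘ splitAt m)
merge-injective {m} {n} f g fi gi dis {x} {y} e =
  trans (sym (Fin.join-splitAt m n x)) (trans (cong (Fin.join m n) (go (splitAt m x) (splitAt m y) e)) (Fin.join-splitAt m n y))
  where
  go : ∀ a b → [ f , g ]′ a ≡ [ f , g ]′ b → a ≡ b
  go (inj₁ i) (inj₁ j) e = cong inj₁ (fi e)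
  go (inj₁ i) (inj₂ j) e = contradiction e (dis i j)
  go (inj₂ i) (inj₁ j) e = contradiction (sym e) (dis j i)
  go (inj₂ i) (inj₂ j) e = cong inj₂ (gi e)

⟦_⟧ : Bool → ℚ
⟦ b ⟧ = if b then 1ℚ else 0ℚ

⟦⟧-injective : ∀ {a b} → ⟦ a ⟧ ≡ ⟦ b ⟧ → a ≡ b
⟦⟧-injective {false} {false} _ = refl
⟦⟧-injective {true}  {true}  _ = refl

cols : ∀ {P Q} → (Fin P → Fin Q → Bool) → Fin Q → Fin P → ℚ
cols M j x = ⟦ M x j ⟧

module _ {P Q : ℕ} (M : Fin P → Fin Q → Bool) {k : ℕ} (g : Fin k → Fin Q) where

  -- Every column of the family is a combination of basis columns whose coefficients are the same in
  -- all rows.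
  agree-on-basis : ∀ {s} (B : Basis (cols M ∘ g) s) a b →
    (∀ i → M a (g (ix (base B) i)) ≡ M b (g (ix (base B) i))) → ∀ j → M a (g j) ≡ M b (g j)
  agree-on-basis B a b e j = ⟦⟧-injective
    (trans (spans B j a) (trans (Σ-cong _ (λ i → cong (λ z → coef (base B) i j *ℚ ⟦ z ⟧) (e i))) (sym (spans B j b))))

  dual-∘ : ∀ {s} → Dual (cols M ∘ g) s → Dual (cols M) s
  dual-∘ D = record { ix = g ∘ ix D ; φ = φ D ; dual = dual D }

-- The zero column can join any family of columns without raising its rank, and all rows agree on
-- it. The zero row keeps the notion symmetric under `transpose`.
record Config (d P Q : ℕ) : Set where
  field
    M             : Fin P → Fin Q → Bool
    rows-distinct : ∀ a b → (∀ j → M a j ≡ M b j) → a ≡ b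
    cols-distinct : ∀ i j → (∀ a → M a i ≡ M a j) → i ≡ j
    zero-row      : ∃ λ a → ∀ j → M a j ≡ false
    zero-col      : ∃ λ j → ∀ a → M a j ≡ false
    rank          : Basis (cols M) d

open Config

transpose : ∀ {d P Q} → Config d P Q → Config d Q P
transpose K = record
  { M = λ j a → M K a j
  ; rows-distinct = cols-distinct K ; cols-distinct = rows-distinct K
  ; zero-row = zero-col K ; zero-col = zero-row K
  ; rank = transpose-basis (rank K) }

basis-size : ∀ {q p} {v : Fin q → Fin p → ℚ} {s d} → Basis v s → Basis v d → s ≡ d
basis-size B B′ = ℕ.≤-antisym (dual≤basis (base B) B′) (dual≤basis (base B′) B)

rows≤2^rank : ∀ {d P Q} → Config d P Q → P ≤ 2 ^ d
rows≤2^rank K = separated⇒≤2^ (λ a i → M K a (ix (base (rank K)) i))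
  (λ a b e → rows-distinct K a b (agree-on-basis (M K) (λ j → j) (rank K) a b e))

-- Some `s` rows form a basis of the rows restricted to the family, and their entries tell its
-- columns apart.
subfamily≤2^rank : ∀ {d P Q k s} (K : Config d P Q) (g : Fin k → Fin Q) →
  Injective _≡_ _≡_ g → Basis (cols (M K) ∘ g) s → k ≤ 2 ^ s
subfamily≤2^rank K g gi B = separated⇒≤2^ (λ j i → M K (ix (base Bᵀ) i) (g j))
  (λ i j e → gi (cols-distinct K (g i) (g j)
    (agree-on-basis (λ j a → M K a (g j)) (λ a → a) Bᵀ i j e)))
  where Bᵀ = transpose-basis B

-- Hyperplanes spanned by all but one basis vector

coef-outside : ∀ {q p k s n} {v : Fin q → Fin p → ℚ} (D : Dual v n) (g : Fin k → Fin q) (B : Basis (v ∘ g) s) i →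
  (∀ b → coef D i (g (ix (base B) b)) ≡ 0ℚ) → ∀ j → coef D i (g j) ≡ 0ℚ
coef-outside {s = s} {v = v} D g B i z j =
  trans (dot-cong (φ D i) (spans B j))
    (trans (dot-comb (φ D i) (λ b → coef (base B) b j) (v ∘ g ∘ ix (base B)))
      (Σ-zero s (λ b → trans (cong (coef (base B) b j *ℚ_) (z b)) (ℚ.*-zeroʳ (coef (base B) b j)))))

-- The basis vector at position `zero` is the distinguished one. `extend` puts new vectors in front,
-- so after a proper extension it is a new vector.
in-hyperplane : ∀ {q p d} {v : Fin q → Fin p → ℚ} → Basis v (suc d) → Fin q → Bool
in-hyperplane B j = does (coef (base B) zero j ℚ.≟ 0ℚ)

off-hyperplane : ∀ {q p d} {v : Fin q → Fin p → ℚ} → Basis v (suc d) → Fin q → Bool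
off-hyperplane B j = not (in-hyperplane B j)

in-hyperplane⁺ : ∀ {q p d} {v : Fin q → Fin p → ℚ} (B : Basis v (suc d)) {j} →
  coef (base B) zero j ≡ 0ℚ → in-hyperplane B j ≡ true
in-hyperplane⁺ B {j} = dec-true (coef (base B) zero j ℚ.≟ 0ℚ)

in-hyperplane⁻ : ∀ {q p d} {v : Fin q → Fin p → ℚ} (B : Basis v (suc d)) {j} →
  in-hyperplane B j ≡ true → coef (base B) zero j ≡ 0ℚ
in-hyperplane⁻ B {j} = does-true (coef (base B) zero j ℚ.≟ 0ℚ)

off-hyperplane⁻ : ∀ {q p d} {v : Fin q → Fin p → ℚ} (B : Basis v (suc d)) {j} →
  off-hyperplane B j ≡ true → coef (base B) zero j ≢ 0ℚ
off-hyperplane⁻ B {j} = does-false (coef (base B) zero j ℚ.≟ 0ℚ)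

1≢0 : 1ℚ ≢ 0ℚ
1≢0 ()

↑ˡ≢↑ʳ : ∀ {t s} (i : Fin t) (b : Fin s) → i ↑ˡ s ≢ t ↑ʳ b
↑ˡ≢↑ʳ {suc t} (suc i) b eq = ↑ˡ≢↑ʳ i b (Fin.suc-injective eq)

-- All of the family and all but one of the new basis vectors lie in the hyperplane
-- opposite to the remaining one.
extension-hyperplane : ∀ {q p k s t} {v : Fin q → Fin p → ℚ} (B : Basis v (suc t + s))
  (g : Fin k → Fin q) → Injective _≡_ _≡_ g → (Bg : Basis (v ∘ g) s) →
  (∀ i → ix (base B) (suc t ↑ʳ i) ≡ g (ix (base Bg) i)) → t + k ≤ count q (in-hyperplane B)
extension-hyperplane {q} {p} {k} {s} {t} {v} B g gi Bg e =
  injection⇒≤count (in-hyperplane B) ([ new , g ]′ ∘ splitAt t)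
    (merge-injective new g new-injective gi new≢g) (λ i → inside (splitAt t i))
  where
  D = base B
  new : Fin t → Fin q
  new i = ix D (suc (i ↑ˡ s))
  new-injective : Injective _≡_ _≡_ new
  new-injective eq = Fin.↑ˡ-injective s _ _ (Fin.suc-injective (ix-injective D eq))
  coef-g : ∀ i → (∀ b → i ≢ suc t ↑ʳ b) → ∀ j → coef D i (g j) ≡ 0ℚ
  coef-g i i≢ = coef-outside D g Bg i
    (λ b → trans (cong (coef D i) (sym (e b))) (trans (dual D i (suc t ↑ʳ b)) (δ-≢ (i≢ b))))
  new≢g : ∀ i j → new i ≢ g j
  new≢g i j eq = 1≢0
    (trans (sym (δ-refl i′)) (trans (sym (dual D i′ i′)) (trans (cong (coef D i′) eq)
      (coef-g i′ (λ b → ↑ˡ≢↑ʳ i b ∘ Fin.suc-injective) j))))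
    where
    i′ : Fin (suc (t + s))
    i′ = suc (i ↑ˡ s)
  inside : ∀ a → in-hyperplane B ([ new , g ]′ a) ≡ true
  inside (inj₁ i) = in-hyperplane⁺ B {new i} (dual D zero (suc (i ↑ˡ s)))
  inside (inj₂ j) = in-hyperplane⁺ B {g j} (coef-g zero (λ b ()) j)

-- Extend a basis of the family to a basis of all vectors. Since `s < suc d`, there is a new vector
-- to distinguish; the other `d - s` new ones and the `k ≥ s + 2` members of the family lie in its
-- hyperplane.
large-hyperplane : ∀ {q p d k s} {v : Fin q → Fin p → ℚ} → Basis v (suc d) →
  (g : Fin k → Fin q) → Injective _≡_ _≡_ g → Basis (v ∘ g) s → s < suc d → 2 + s ≤ k →
  Σ (Basis v (suc d)) λ B → 2 + d ≤ count q (in-hyperplane B)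
large-hyperplane {q} {p} {d} {k} {s} {v} B₀ g gi Bg s<d k≥ = go (extend D)
  where
  D : Dual v s
  D = record { ix = g ∘ ix (base Bg) ; φ = φ (base Bg) ; dual = dual (base Bg) }
  open ℕ.≤-Reasoning
  resize : ∀ {n} → n ≡ d → (B : Basis v (suc n)) → 2 + n ≤ count q (in-hyperplane B) →
    Σ (Basis v (suc d)) λ B → 2 + d ≤ count q (in-hyperplane B)
  resize refl B le = B , le
  go : (∃ λ t → Σ (Basis v (t + s)) λ B → ∀ i → ix (base B) (t ↑ʳ i) ≡ ix D i) →
    Σ (Basis v (suc d)) λ B → 2 + d ≤ count q (in-hyperplane B)
  go (zero  , B , e) = contradiction s<d (ℕ.<-irrefl (basis-size B B₀))
  go (suc t , B , e) = resize (ℕ.suc-injective (basis-size B B₀)) B (begin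
    2 + (t + s)     ≡⟨ cong suc (sym (ℕ.+-suc t s)) ⟩
    suc (t + suc s) ≡⟨ sym (ℕ.+-suc t (suc s)) ⟩
    t + (2 + s)     ≤⟨ ℕ.+-monoʳ-≤ t k≥ ⟩
    t + k           ≤⟨ extension-hyperplane {t = t} B g gi Bg e ⟩
    count q (in-hyperplane B) ∎)

not-true : ∀ {b} → b ≡ false → not b ≡ true
not-true refl = refl

-- If a ≠ a′, one equation forces k ≥ 0 and the other k ≤ 0.
jump-determines-value : ∀ a b a′ b′ k → ⟦ a ⟧ ≡ ⟦ b ⟧ +ℚ k → ⟦ a′ ⟧ ≡ ⟦ b′ ⟧ +ℚ k → k ≢ 0ℚ → a ≡ a′
jump-determines-value a b a′ b′ k e e′ k≢0 = go a b a′ b′ (solveFor e) (solveFor e′)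
  where
  open +-*-Solver using (solve; _:=_; _:+_; _:*_; _:-_; con)

  solveFor : ∀ {x y} → x ≡ y +ℚ k → k ≡ x -ℚ y
  solveFor {y = y} refl = solve 2 (λ y k → k := (y :+ k) :- y) refl y k
  go : ∀ a b a′ b′ → k ≡ ⟦ a ⟧ -ℚ ⟦ b ⟧ → k ≡ ⟦ a′ ⟧ -ℚ ⟦ b′ ⟧ → a ≡ a′
  go false _     false _     _ _ = refl
  go true  _     true  _     _ _ = refl
  go false false true  _     u _ = contradiction u k≢0
  go false true  true  true  _ w = contradiction w k≢0
  go false true  true  false u w = contradiction (trans (sym u) w) λ ()
  go true  true  false _     u _ = contradiction u k≢0
  go true  false false false _ w = contradiction w k≢0
  go true  false false true  u w = contradiction (trans (sym u) w) λ ()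

-- Cutting a configuration along a hyperplane

module Cut {d P Q : ℕ} (K : Config (suc d) P Q) (B : Basis (cols (M K)) (suc d)) where

  N : Fin P → Fin Q → Bool
  N = M K

  D : Dual (cols N) (suc d)
  D = base B

  pivot : Fin Q
  pivot = ix D zero

  EH : Enumeration (in-hyperplane B) (count Q (in-hyperplane B))
  EH = enumerate (in-hyperplane B)

  ET : Enumeration (off-hyperplane B) (count Q (off-hyperplane B))
  ET = enumerate (off-hyperplane B)

  h : Fin (count Q (in-hyperplane B)) → Fin Q
  h = elem EH

  Agree : Fin P → Fin P → Set
  Agree a b = ∀ j → N a (h j) ≡ N b (h j)

  agree-at : ∀ {a b} → Agree a b → ∀ {j} → in-hyperplane B j ≡ true → N a j ≡ N b j
  agree-at {a} {b} ag {j} hj = subst (λ j → N a j ≡ N b j) (elem-index EH j hj) (ag (index EH j hj))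

  agree-at-suc : ∀ {a b} → Agree a b → ∀ i → N a (ix D (suc i)) ≡ N b (ix D (suc i))
  agree-at-suc ag i = agree-at ag (in-hyperplane⁺ B (dual D zero (suc i)))

  -- The basis columns other than the pivot lie in the hyperplane, so such rows agree on the whole
  -- basis.
  agree⇒≡ : ∀ {a b} → Agree a b → N a pivot ≡ N b pivot → a ≡ b
  agree⇒≡ {a} {b} ag e = rows-distinct K a b (agree-on-basis N (λ j → j) B a b
    λ { zero → e ; (suc i) → agree-at-suc ag i })

  -- Rows that agree on the hyperplane are told apart by their pivot entry, so they come at most in
  -- pairs. The upper row of a pair, with entry 1 at the pivot, is the one to drop.
  Removed : Fin P → Set
  Removed a = N a pivot ≡ true × ∃ λ b → N b pivot ≡ false × Agree a b

  removed? : ∀ a → Dec (Removed a)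
  removed? a = (N a pivot Bool.≟ true) ×-dec
    Fin.any? (λ b → (N b pivot Bool.≟ false) ×-dec Fin.all? (λ j → N a (h j) Bool.≟ N b (h j)))

  removed kept : Fin P → Bool
  removed a = does (removed? a)
  kept a    = not (removed a)

  ER : Enumeration removed (count P removed)
  ER = enumerate removed

  EK : Enumeration kept (count P kept)
  EK = enumerate kept

  Removed-elem : ∀ i → Removed (elem ER i)
  Removed-elem i = does-true (removed? (elem ER i)) (sound ER i)

  low-kept : ∀ {b} → N b pivot ≡ false → kept b ≡ true
  low-kept {b} e = not-true (dec-false (removed? b) (λ (t , _) → contradiction (trans (sym t) e) λ ()))

  -- Restriction to the kept rows loses nothing on the hyperplane: identities between its columns,
  -- checked on kept rows, hold on all rows.
  representative : ∀ a → ∃ λ i → Agree a (elem EK i)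
  representative a = go (removed? a)
    where
    kept-representative : ∀ {b} → kept b ≡ true → Agree a b → ∃ λ i → Agree a (elem EK i)
    kept-representative {b} kb ag = index EK b kb ,
      λ j → trans (ag j) (cong (λ x → N x (h j)) (sym (elem-index EK b kb)))
    go : Dec (Removed a) → ∃ λ i → Agree a (elem EK i)
    go (yes (_ , b , e , ag)) = kept-representative (low-kept e) ag
    go (no ¬r) = kept-representative (not-true (dec-false (removed? a) ¬r)) (λ _ → refl)

  N′ : Fin (count P kept) → Fin (count Q (in-hyperplane B)) → Bool
  N′ a j = N (elem EK a) (h j)

  ¬both : ∀ {a b} → kept a ≡ true → Agree a b → N a pivot ≡ true → N b pivot ≡ false → a ≡ b
  ¬both {a} {b} ka ag ta fb = contradiction (ta , b , fb , ag) (does-false (removed? a) ka)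

  kept-distinct : ∀ {a b} → kept a ≡ true → kept b ≡ true → Agree a b → a ≡ b
  kept-distinct {a} {b} ka kb ag = go (N a pivot) (N b pivot) refl refl
    where
    go : ∀ x y → N a pivot ≡ x → N b pivot ≡ y → a ≡ b
    go true  true  ea eb = agree⇒≡ ag (trans ea (sym eb))
    go false false ea eb = agree⇒≡ ag (trans ea (sym eb))
    go true  false ea eb = ¬both ka ag ea eb
    go false true  ea eb = sym (¬both kb (sym ∘ ag) eb ea)

  zc : Fin Q
  zc = proj₁ (zero-col K)

  zc-in : in-hyperplane B zc ≡ true
  zc-in = in-hyperplane⁺ B {zc} (dot-zero (φ D zero) {cols N zc} (λ a → cong ⟦_⟧ (proj₂ (zero-col K) a)))

  suc-in : ∀ i → in-hyperplane B (ix D (suc i)) ≡ true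
  suc-in i = in-hyperplane⁺ B (dual D zero (suc i))

  -- Columns of the hyperplane have pivot coordinate 0, so the other `d` basis columns span them,
  -- also after restriction to the kept rows.
  sub-dual≤d : ∀ {e} → Dual (cols N′) e → e ≤ d
  sub-dual≤d D′ = independent⇒≤ (cols N′ ∘ ix D′) (λ i b → coef D (suc b) (h (ix D′ i)))
    (λ b a → ⟦ N (elem EK a) (ix D (suc b)) ⟧) (independent D′)
    (λ i a → trans (spans B (h (ix D′ i)) (elem EK a))
      (trans (cong (_+ℚ rest i a)
        (trans (cong (_*ℚ ⟦ N (elem EK a) pivot ⟧) (in-hyperplane⁻ B (sound EH (ix D′ i))))
          (ℚ.*-zeroˡ ⟦ N (elem EK a) pivot ⟧)))
        (ℚ.+-identityˡ (rest i a))))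
    where
    rest : Fin _ → Fin (count P kept) → ℚ
    rest i a = Σℚ d (λ b → coef D (suc b) (h (ix D′ i)) *ℚ ⟦ N (elem EK a) (ix D (suc b)) ⟧)

  -- The `d` basis columns other than the pivot are independent over all rows. Their expansions in
  -- `B′` over the kept rows extend to all rows through `representative`.
  d≤sub-basis : ∀ {e} → Basis (cols N′) e → d ≤ e
  d≤sub-basis {e} B′ = independent⇒≤ (cols N ∘ ix tail) (λ i b → coef D′ b (idx i))
    (λ b a → ⟦ N a (h (ix D′ b)) ⟧) (independent tail) expand
    where
    D′ = base B′
    idx : Fin d → Fin (count Q (in-hyperplane B))
    idx i = index EH (ix D (suc i)) (suc-in i)
    tail : Dual (cols N) d
    tail = record { ix = ix D ∘ suc ; φ = φ D ∘ suc ; dual = λ i j → dual D (suc i) (suc j) }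
    open ≡-Reasoning
    expand : ∀ i a → ⟦ N a (ix D (suc i)) ⟧ ≡ Σℚ e (λ b → coef D′ b (idx i) *ℚ ⟦ N a (h (ix D′ b)) ⟧)
    expand i a = begin
      ⟦ N a (ix D (suc i)) ⟧
        ≡⟨ cong (λ j → ⟦ N a j ⟧) (sym (elem-index EH (ix D (suc i)) (suc-in i))) ⟩
      ⟦ N a (h (idx i)) ⟧
        ≡⟨ cong ⟦_⟧ (ag (idx i)) ⟩
      ⟦ N′ k (idx i) ⟧
        ≡⟨ spans B′ (idx i) k ⟩
      Σℚ e (λ b → coef D′ b (idx i) *ℚ ⟦ N′ k (ix D′ b) ⟧)
        ≡⟨ Σ-cong e (λ b → cong (λ z → coef D′ b (idx i) *ℚ ⟦ z ⟧) (sym (ag (ix D′ b)))) ⟩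
      Σℚ e (λ b → coef D′ b (idx i) *ℚ ⟦ N a (h (ix D′ b)) ⟧) ∎
      where
      k = proj₁ (representative a)
      ag = proj₂ (representative a)

  sub-basis : Basis (cols N′) d
  sub-basis = resize basis
    where
    resize : (∃ λ e → Basis (cols N′) e) → Basis (cols N′) d
    resize (e , B′) = subst (Basis (cols N′)) (ℕ.≤-antisym (sub-dual≤d (base B′)) (d≤sub-basis B′)) B′

  sub : Config d (count P kept) (count Q (in-hyperplane B))
  sub = record
    { M = N′
    ; rows-distinct = λ a b e → injective EK (kept-distinct (sound EK a) (sound EK b) e)
    ; cols-distinct = λ i j e → injective EH (cols-distinct K (h i) (h j)
        (λ a → let (k , ag) = representative a in trans (ag i) (trans (e k) (sym (ag j)))))
    ; zero-row = let (z , zz) = zero-row K ; kz = low-kept (zz pivot) in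
        index EK z kz , λ j → trans (cong (λ x → N x (h j)) (elem-index EK z kz)) (zz (h j))
    ; zero-col = index EH zc zc-in , λ a →
        trans (cong (N (elem EK a)) (elem-index EH zc zc-in)) (proj₂ (zero-col K) (elem EK a))
    ; rank = sub-basis }

  rows-split : count P kept + count P removed ≡ P
  rows-split = trans (ℕ.+-comm (count P kept) (count P removed)) (count-complement P removed kept (λ _ → refl))

  cols-split : count Q (in-hyperplane B) + count Q (off-hyperplane B) ≡ Q
  cols-split = count-complement Q (in-hyperplane B) (off-hyperplane B) (λ _ → refl)

  -- Send a removed row to its lower partner, which is kept. Two removed rows with the same partner
  -- agree on the hyperplane and at the pivot.
  removed≤kept : count P removed ≤ count P kept
  removed≤kept = Fin.injective⇒≤ {f = f} f-injective
    where
    low : Fin (count P removed) → Fin P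
    low i = proj₁ (proj₂ (Removed-elem i))
    low-is-kept : ∀ i → kept (low i) ≡ true
    low-is-kept i = low-kept (proj₁ (proj₂ (proj₂ (Removed-elem i))))
    low-agrees : ∀ i → Agree (elem ER i) (low i)
    low-agrees i = proj₂ (proj₂ (proj₂ (Removed-elem i)))
    f : Fin (count P removed) → Fin (count P kept)
    f i = index EK (low i) (low-is-kept i)
    f-injective : Injective _≡_ _≡_ f
    f-injective {i} {j} eq = injective ER (agree⇒≡
      (λ c → trans (low-agrees i c) (trans (cong (λ x → N x (h c)) low≡) (sym (low-agrees j c))))
      (trans (proj₁ (Removed-elem i)) (sym (proj₁ (Removed-elem j)))))
      where
      low≡ : low i ≡ low j
      low≡ = trans (sym (elem-index EK (low i) (low-is-kept i)))
        (trans (cong (elem EK) eq) (elem-index EK (low j) (low-is-kept j)))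

  -- The two rows of a pair have equal entries in all basis columns but the pivot, where they differ
  -- by 1. Only the pivot coordinate of `c` survives in the difference.
  jump : ∀ {a b} → N a pivot ≡ true → N b pivot ≡ false → Agree a b → ∀ c →
    ⟦ N a c ⟧ ≡ ⟦ N b c ⟧ +ℚ coef D zero c
  jump {a} {b} ta fb ag c = begin
    ⟦ N a c ⟧                            ≡⟨ spans B c a ⟩
    k *ℚ ⟦ N a pivot ⟧ +ℚ rest a         ≡⟨ cong₂ (λ x y → k *ℚ ⟦ x ⟧ +ℚ y) ta rest≡ ⟩
    k *ℚ 1ℚ +ℚ rest b                    ≡⟨ solve 2 (λ k r → k :* con 1ℚ :+ r := (k :* con 0ℚ :+ r) :+ k) refl k (rest b) ⟩
    (k *ℚ 0ℚ +ℚ rest b) +ℚ k             ≡⟨ cong (λ x → (k *ℚ ⟦ x ⟧ +ℚ rest b) +ℚ k) (sym fb) ⟩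
    (k *ℚ ⟦ N b pivot ⟧ +ℚ rest b) +ℚ k  ≡⟨ cong (_+ℚ k) (sym (spans B c b)) ⟩
    ⟦ N b c ⟧ +ℚ k                       ∎
    where
    open ≡-Reasoning
    open +-*-Solver using (solve; _:=_; _:+_; _:*_; _:-_; con)
    k = coef D zero c
    rest : Fin P → ℚ
    rest x = Σℚ d (λ i → coef D (suc i) c *ℚ ⟦ N x (ix D (suc i)) ⟧)
    rest≡ : rest a ≡ rest b
    rest≡ = Σ-cong d (λ i → cong (λ z → coef D (suc i) c *ℚ ⟦ z ⟧) (agree-at-suc ag i))

  -- Off the hyperplane the difference within a pair is a nonzero number that depends on the column
  -- only, and its sign fixes the entry of the upper row.
  removed-constant : ∀ {a a′} → Removed a → Removed a′ → ∀ {c} → off-hyperplane B c ≡ true → N a c ≡ N a′ c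
  removed-constant {a} {a′} (ta , b , fb , ag) (ta′ , b′ , fb′ , ag′) {c} off =
    jump-determines-value (N a c) (N b c) (N a′ c) (N b′ c) (coef D zero c)
      (jump ta fb ag c) (jump ta′ fb′ ag′ c) (off-hyperplane⁻ B off)

  -- Prepending the zero column costs no rank. It improves the count of columns to `suc τ ≤ 2 ^ s`,
  -- and it lets `large-hyperplane` apply as soon as `τ > s`.
  g⁺ : Fin (suc (count Q (off-hyperplane B))) → Fin Q
  g⁺ zero    = zc
  g⁺ (suc i) = elem ET i

  zc≢ : ∀ i → zc ≢ elem ET i
  zc≢ i e = off-hyperplane⁻ B (sound ET i) (in-hyperplane⁻ B (trans (cong (in-hyperplane B) (sym e)) zc-in))

  g⁺-injective : Injective _≡_ _≡_ g⁺
  g⁺-injective {zero}  {zero}  e = refl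
  g⁺-injective {zero}  {suc j} e = contradiction e (zc≢ j)
  g⁺-injective {suc i} {zero}  e = contradiction (sym e) (zc≢ i)
  g⁺-injective {suc i} {suc j} e = cong suc (injective ET e)

  g⁺-constant : ∀ {a a′} → Removed a → Removed a′ → ∀ i → N a (g⁺ i) ≡ N a′ (g⁺ i)
  g⁺-constant {a} {a′} _ _ zero = trans (proj₂ (zero-col K) a) (sym (proj₂ (zero-col K) a′))
  g⁺-constant ra ra′ (suc i)    = removed-constant ra ra′ (sound ET i)

  -- Removed rows agree on the `s` basis columns taken from `g⁺`, so the other `t` basis columns
  -- must tell them apart.
  removed≤2^ : ∀ {s t} (Bg : Basis (cols N ∘ g⁺) s) (B′ : Basis (cols N) (t + s)) →
    (∀ i → ix (base B′) (t ↑ʳ i) ≡ g⁺ (ix (base Bg) i)) → count P removed ≤ 2 ^ t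
  removed≤2^ {s} {t} Bg B′ e = separated⇒≤2^ (λ a i → N (elem ER a) (ix (base B′) (i ↑ˡ s)))
    (λ a b eq → injective ER (rows-distinct K _ _ (agree-on-basis N (λ j → j) B′ _ _ (onBasis a b eq))))
    where
    onBasis : ∀ a b → (∀ i → N (elem ER a) (ix (base B′) (i ↑ˡ s)) ≡ N (elem ER b) (ix (base B′) (i ↑ˡ s))) →
      ∀ i → N (elem ER a) (ix (base B′) i) ≡ N (elem ER b) (ix (base B′) i)
    onBasis a b eq i = subst (λ i → N (elem ER a) (ix (base B′) i) ≡ N (elem ER b) (ix (base B′) i))
      (Fin.join-splitAt t s i) (go (splitAt t i))
      where
      go : ∀ z → N (elem ER a) (ix (base B′) (Fin.join t s z)) ≡ N (elem ER b) (ix (base B′) (Fin.join t s z))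
      go (inj₁ i) = eq i
      go (inj₂ i) = subst (λ c → N (elem ER a) c ≡ N (elem ER b) c) (sym (e i))
        (g⁺-constant (Removed-elem a) (Removed-elem b) (ix (base Bg) i))

-- What the counting needs from a cut: `m` rows are removed, `τ` columns lie off the hyperplane,
-- `off` lists these together with the zero column, and `s` is the rank of `off`.
record Split {d P Q : ℕ} (K : Config (suc d) P Q) (Q′ : ℕ) : Set where
  field
    {P′ m τ s t} : ℕ
    sub        : Config d P′ Q′
    rows-split : P′ + m ≡ P
    cols-split : Q′ + τ ≡ Q
    rank-split : t + s ≡ suc d
    m≤P′       : m ≤ P′
    m≤2^t      : m ≤ 2 ^ t
    τ<2^s      : suc τ ≤ 2 ^ s
    off        : Fin (suc τ) → Fin Q
    off-injective : Injective _≡_ _≡_ off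
    off-basis  : Basis (cols (M K) ∘ off) s

split : ∀ {d P Q} (K : Config (suc d) P Q) (B : Basis (cols (M K)) (suc d)) →
  Split K (count Q (in-hyperplane B))
split {d} K B = go basis
  where
  open Cut K B
  go : (∃ λ s → Basis (cols N ∘ g⁺) s) → _
  go (s , Bg) = go′ (extend (dual-∘ N g⁺ (base Bg)))
    where
    go′ : (∃ λ t → Σ (Basis (cols N) (t + s)) λ B′ → ∀ i → ix (base B′) (t ↑ʳ i) ≡ g⁺ (ix (base Bg) i)) → _
    go′ (t , B′ , e) = record
      { sub = sub ; rows-split = rows-split ; cols-split = cols-split
      ; rank-split = basis-size B′ B
      ; m≤P′ = removed≤kept
      ; m≤2^t = removed≤2^ {s} {t} Bg B′ e
      ; τ<2^s = subfamily≤2^rank K g⁺ g⁺-injective Bg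
      ; off = g⁺ ; off-injective = g⁺-injective ; off-basis = Bg }

-- Arithmetic

infixl 6 _⊕_
_⊕_ : ∀ {a b c d} → a ≤ b → c ≤ d → a + c ≤ b + d
_⊕_ = ℕ.+-mono-≤

-- A ≤ B from a sum of hypotheses L ≤ R, after adding c to both sides and discarding the slack k.
linear : ∀ {A B L R} c k → L ≤ R → A + c ≡ L → R + k ≡ B + c → A ≤ B
linear {A} {B} c k L≤R eA eB = ℕ.+-cancelʳ-≤ c A B
  (ℕ.≤-trans (ℕ.≤-reflexive eA) (ℕ.≤-trans L≤R (ℕ.≤-trans (ℕ.m≤m+n _ k) (ℕ.≤-reflexive eB))))

1≤2^ : ∀ n → 1 ≤ 2 ^ n
1≤2^ n = ℕ.m^n>0 2 n

suc≤2^ : ∀ n → suc n ≤ 2 ^ n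
suc≤2^ zero    = s≤s z≤n
suc≤2^ (suc n) = linear 0 0 (1≤2^ n ⊕ suc≤2^ n) (ring (n ∷ [])) (eq (2 ^ n))
  where
  eq : ∀ x → x + x + 0 ≡ 2 * x + 0
  eq x = ring (x ∷ [])

scale-< : ∀ k {n z} → n < z → k + k * n ≤ k * z
scale-< k {n} {z} h = subst (_≤ k * z) (ℕ.*-suc k n) (ℕ.*-monoʳ-≤ k h)

-- For the two powers `a` and `b` this is `(a - 1) * (b - 1) ≥ 0`.
2^+2^≤ : ∀ u w → 2 ^ u + 2 ^ w ≤ 2 ^ (u + w) + 1
2^+2^≤ u w rewrite ℕ.^-distribˡ-+-* 2 u w = go (2 ^ u) (2 ^ w) (1≤2^ u) (1≤2^ w)
  where
  go : ∀ a b → 1 ≤ a → 1 ≤ b → a + b ≤ a * b + 1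
  go (suc a) (suc b) _ _ = linear {L = suc a + suc b} 0 (a * b) ℕ.≤-refl (ring (a ∷ b ∷ [])) (ring (a ∷ b ∷ []))

2^+n≤ : ∀ w u → 2 ^ w + u ≤ 2 ^ (w + u)
2^+n≤ w u = linear (2 ^ u + 1) 0 (2^+2^≤ w u ⊕ suc≤2^ u) (eq (2 ^ w) (2 ^ u)) (eq′ (2 ^ (w + u)) (2 ^ u))
  where
  eq : ∀ a b → a + u + (b + 1) ≡ a + b + suc u
  eq a b = ring (a ∷ b ∷ u ∷ [])
  eq′ : ∀ x b → x + 1 + b + 0 ≡ x + (b + 1)
  eq′ x b = ring (x ∷ b ∷ [])


overflow : ∀ {L R} k → L ≤ R → L ≡ R + suc k → ⊥
overflow {L} {R} k L≤R refl = ℕ.m+1+n≰m R L≤R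

-- For `s ≤ 1` there are too few columns to reach `4 + e`. For `s = 2 + u` the up to `u` surplus
-- columns are paid for by `m ≤ 2 ^ t ≤ 2 ^ e - u`, where `e = t + u`.
uniform-bound : ∀ {e P′ Q′ m τ} s t → P′ ≤ 2 ^ (1 + e) → m ≤ 2 ^ t → t + s ≡ 2 + e →
  Q′ ≤ 2 + e → τ ≤ s → 4 + e ≤ Q′ + τ → P′ + m + (Q′ + τ) ≤ 3 * 2 ^ e + (4 + e)
uniform-bound {e} {P′} {Q′} {m} {τ} zero t hP hm hts hQ hτ hQ4 =
  ⊥-elim (overflow 1 (hQ4 ⊕ hQ ⊕ hτ) (ring (e ∷ Q′ ∷ τ ∷ [])))
uniform-bound {e} {P′} {Q′} {m} {τ} (suc zero) t hP hm hts hQ hτ hQ4 =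
  ⊥-elim (overflow 0 (hQ4 ⊕ hQ ⊕ hτ) (ring (e ∷ Q′ ∷ τ ∷ [])))
uniform-bound {e} {P′} {Q′} {m} {τ} (suc (suc u)) t hP hm hts hQ hτ hQ4
  with ℕ.suc-injective (ℕ.suc-injective (trans (sym (trans (ℕ.+-suc t (suc u)) (cong suc (ℕ.+-suc t u)))) hts))
... | refl = go (2 ^ (t + u)) (2 ^ t) hP hm (2^+n≤ t u)
  where
  go : ∀ y b → P′ ≤ 2 * y → m ≤ b → b + u ≤ y → P′ + m + (Q′ + τ) ≤ 3 * y + (4 + (t + u))
  go y b hP hm hb = linear (b + u) 0 (hP ⊕ hm ⊕ hQ ⊕ hτ ⊕ hb)
    (ring (P′ ∷ Q′ ∷ m ∷ τ ∷ b ∷ u ∷ [])) (ring (y ∷ b ∷ t ∷ u ∷ []))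

-- For `e ≤ 2` the estimate `P + Q ≤ 2 * P` suffices, with equality possible at `e = 2`. From
-- `e = 3` on `2 ^ e ≥ 1 + 2 * e`, and the linear bound on `Q` is good enough.
full-bound : ∀ e {P Q} → P ≤ 2 ^ (1 + e) + 1 → Q ≤ P → Q ≤ 4 + 3 * e → P + Q ≤ 3 * 2 ^ e + (4 + e)
full-bound 0 {P} {Q} hP hQ _ = linear P 1 (hP ⊕ hP ⊕ hQ) (ring (P ∷ Q ∷ [])) (ring (P ∷ []))
full-bound 1 {P} {Q} hP hQ _ = linear P 1 (hP ⊕ hP ⊕ hQ) (ring (P ∷ Q ∷ [])) (ring (P ∷ []))
full-bound 2 {P} {Q} hP hQ _ = linear P 0 (hP ⊕ hP ⊕ hQ) (ring (P ∷ Q ∷ [])) (ring (P ∷ []))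
full-bound (suc (suc (suc n))) {P} {Q} hP _ hQ = go (2 ^ n) hP (suc≤2^ n)
  where
  go : ∀ z → P ≤ 2 * (2 * (2 * (2 * z))) + 1 → suc n ≤ z → P + Q ≤ 3 * (2 * (2 * (2 * z))) + (7 + n)
  go z hP hz = linear (8 + 8 * n) (1 + 6 * n) (hP ⊕ hQ ⊕ scale-< 8 hz)
    (ring (P ∷ Q ∷ n ∷ [])) (ring (z ∷ n ∷ []))

-- The induction step when the hyperplane contains 4 + f columns; hI is the induction hypothesis.
module _ {f P′ Q′ m τ : ℕ} (hQ′ : 4 + f ≤ Q′) (hQP : Q′ + τ ≤ P′ + m) (Q′≤ : Q′ ≤ 2 ^ (2 + f)) (m≤P′ : m ≤ P′)
  (hI : 4 + f ≤ P′ → P′ + Q′ ≤ 3 * 2 ^ f + (4 + f)) where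

  -- The sum is at most `2 * P′ + Q′ + 1`, which is twice the sum in the induction hypothesis, less
  -- `Q′ ≥ 4 + f`, plus 1.
  small-τ-bound : suc τ ≤ 2 → P′ + m + (Q′ + τ) ≤ 3 * 2 ^ (1 + f) + (5 + f)
  small-τ-bound hτ with 4 + f ℕ.≤? P′
  ... | yes hP = go (2 ^ f) (hI hP)
    where
    go : ∀ x → P′ + Q′ ≤ 3 * x + (4 + f) → P′ + m + (Q′ + τ) ≤ 3 * (2 * x) + (5 + f)
    go x h = linear (P′ + Q′ + 5 + f) 0 (h ⊕ h ⊕ m≤P′ ⊕ hτ ⊕ hQ′)
      (ring (P′ ∷ Q′ ∷ m ∷ τ ∷ f ∷ [])) (ring (P′ ∷ Q′ ∷ x ∷ f ∷ []))
  ... | no hP = go (2 ^ f) Q′≤ (suc≤2^ f) (ℕ.≤-pred (ℕ.≰⇒> hP))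
    where
    go : ∀ x → Q′ ≤ 2 * (2 * x) → suc f ≤ x → P′ ≤ 3 + f → P′ + m + (Q′ + τ) ≤ 3 * (2 * x) + (5 + f)
    go x hQ hx h = linear (P′ + 3 + 2 * f) f (m≤P′ ⊕ h ⊕ h ⊕ hQ ⊕ hτ ⊕ hx ⊕ hx)
      (ring (P′ ∷ Q′ ∷ m ∷ τ ∷ f ∷ [])) (ring (P′ ∷ x ∷ f ∷ []))

  -- As `Q ≤ P`, the sum is at most `2 * (P′ + m)`. The induction hypothesis and `Q′ ≥ 4 + f` give
  -- `P′ ≤ 3 * 2 ^ f`.
  small-m-bound : m ≤ 2 → P′ + m + (Q′ + τ) ≤ 3 * 2 ^ (1 + f) + (5 + f)
  small-m-bound hm with 4 + f ℕ.≤? P′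
  ... | yes hP = go (2 ^ f) (hI hP)
    where
    go : ∀ x → P′ + Q′ ≤ 3 * x + (4 + f) → P′ + m + (Q′ + τ) ≤ 3 * (2 * x) + (5 + f)
    go x h = linear (P′ + m + 2 * Q′ + 8 + 2 * f) (1 + f) (h ⊕ h ⊕ hQ′ ⊕ hQ′ ⊕ hm ⊕ hm ⊕ hQP)
      (ring (P′ ∷ Q′ ∷ m ∷ τ ∷ f ∷ [])) (ring (P′ ∷ Q′ ∷ m ∷ x ∷ f ∷ []))
  ... | no hP = go (2 ^ f) (suc≤2^ f) (ℕ.≤-pred (ℕ.≰⇒> hP))
    where
    go : ∀ x → suc f ≤ x → P′ ≤ 3 + f → P′ + m + (Q′ + τ) ≤ 3 * (2 * x) + (5 + f)
    go x hx h = linear (P′ + m + 6 + 6 * f) (1 + 5 * f) (hQP ⊕ h ⊕ h ⊕ hm ⊕ hm ⊕ scale-< 6 hx)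
      (ring (P′ ∷ Q′ ∷ m ∷ τ ∷ f ∷ [])) (ring (P′ ∷ m ∷ x ∷ f ∷ []))

  -- With `z = 2 ^ (w + u)`, the cut loses at most `m + τ ≤ 4 * z + 3` rows and columns, while the
  -- target exceeds the induction hypothesis by `6 * z + 1`.
  large-bound : ∀ u w → f ≡ 1 + (w + u) → m ≤ 2 ^ (2 + w) → suc τ ≤ 2 ^ (2 + u) →
    P′ + m + (Q′ + τ) ≤ 3 * 2 ^ (1 + f) + (5 + f)
  large-bound u w refl hm hτ with 5 + (w + u) ℕ.≤? P′
  ... | yes hP = go (2 ^ w) (2 ^ u) (2 ^ (w + u)) (w + u) hm hτ (2^+2^≤ w u) (1≤2^ (w + u)) (hI hP)
    where
    go : ∀ a b z g → m ≤ 2 * (2 * a) → suc τ ≤ 2 * (2 * b) → a + b ≤ z + 1 → 1 ≤ z →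
      P′ + Q′ ≤ 3 * (2 * z) + (5 + g) → P′ + m + (Q′ + τ) ≤ 3 * (2 * (2 * z)) + (6 + g)
    go a b z g hm hτ hab hz h = linear (3 + 4 * a + 4 * b) 0 (h ⊕ hm ⊕ hτ ⊕ hab ⊕ hab ⊕ hab ⊕ hab ⊕ hz ⊕ hz)
      (ring (P′ ∷ Q′ ∷ m ∷ τ ∷ a ∷ b ∷ [])) (ring (a ∷ b ∷ z ∷ g ∷ []))
  -- Too few rows for the induction hypothesis; here `Q ≤ P ≤ 2 * P′` bounds everything linearly.
  ... | no hP = go (2 ^ (w + u)) (w + u) (suc≤2^ (w + u)) (ℕ.≤-pred (ℕ.≰⇒> hP))
    where
    go : ∀ z g → suc g ≤ z → P′ ≤ 4 + g → P′ + m + (Q′ + τ) ≤ 3 * (2 * (2 * z)) + (6 + g)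
    go z g hz h = linear (m + 3 * P′ + 12 + 12 * g) (2 + 9 * g)
      (hQP ⊕ m≤P′ ⊕ m≤P′ ⊕ h ⊕ h ⊕ h ⊕ h ⊕ scale-< 12 hz)
      (ring (P′ ∷ Q′ ∷ m ∷ τ ∷ g ∷ [])) (ring (P′ ∷ m ∷ z ∷ g ∷ []))

  hyperplane-bound : ∀ s t → t + s ≡ 3 + f → m ≤ 2 ^ t → suc τ ≤ 2 ^ s →
    P′ + m + (Q′ + τ) ≤ 3 * 2 ^ (1 + f) + (5 + f)
  hyperplane-bound 0 t _ _ hτ = small-τ-bound (ℕ.m≤n⇒m≤1+n hτ)
  hyperplane-bound 1 t _ _ hτ = small-τ-bound hτ
  hyperplane-bound (suc (suc u)) 0 _ hm _ = small-m-bound (ℕ.m≤n⇒m≤1+n hm)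
  hyperplane-bound (suc (suc u)) 1 _ hm _ = small-m-bound hm
  hyperplane-bound (suc (suc u)) (suc (suc w)) e hm hτ = large-bound u w
    (ℕ.suc-injective (ℕ.suc-injective (ℕ.suc-injective (trans (sym e) (ring (u ∷ w ∷ [])))))) hm hτ

-- The bound on P + Q

agreement : ∀ {n} → (Fin n → Bool) → (Fin n → Bool) → Fin n → Bool
agreement x y j = does (x j Bool.≟ y j)

weight : Bool → ℕ
weight b = if b then 1 else 0

pigeonhole-bits : ∀ a b c →
  1 ≤ weight (does (a Bool.≟ b)) + weight (does (a Bool.≟ c)) + weight (does (b Bool.≟ c))
pigeonhole-bits true  true  c     = s≤s z≤n
pigeonhole-bits false false c     = s≤s z≤n
pigeonhole-bits true  false true  = s≤s z≤n
pigeonhole-bits true  false false = s≤s z≤n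
pigeonhole-bits false true  true  = s≤s z≤n
pigeonhole-bits false true  false = s≤s z≤n

interchange₃ : ∀ a A b B c C → (a + b + c) + (A + B + C) ≡ (a + A) + (b + B) + (c + C)
interchange₃ a A b B c C = ring (a ∷ A ∷ b ∷ B ∷ c ∷ C ∷ [])

agreements : ∀ n (x y z : Fin n → Bool) →
  n ≤ count n (agreement x y) + count n (agreement x z) + count n (agreement y z)
agreements zero    x y z = z≤n
agreements (suc n) x y z = ℕ.≤-trans
  (pigeonhole-bits (x zero) (y zero) (z zero) ⊕ agreements n (x ∘ suc) (y ∘ suc) (z ∘ suc))
  (ℕ.≤-reflexive (interchange₃ (weight (agreement x y zero)) _ (weight (agreement x z zero)) _ (weight (agreement y z zero)) _))

-- At `j` all three pairs agree, so `j` contributes 3, where any other index is only sure to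
-- contribute 1.
agreements⁺ : ∀ n (x y z : Fin n → Bool) j → x j ≡ false → y j ≡ false → z j ≡ false →
  2 + n ≤ count n (agreement x y) + count n (agreement x z) + count n (agreement y z)
agreements⁺ (suc n) x y z zero ex ey ez rewrite ex | ey | ez = ℕ.≤-trans
  (ℕ.+-monoʳ-≤ 3 (agreements n (x ∘ suc) (y ∘ suc) (z ∘ suc)))
  (ℕ.≤-reflexive (interchange₃ 1 (count n (agreement (x ∘ suc) (y ∘ suc))) 1 (count n (agreement (x ∘ suc) (z ∘ suc))) 1 _))
agreements⁺ (suc n) x y z (suc j) ex ey ez = ℕ.≤-trans
  (pigeonhole-bits (x zero) (y zero) (z zero) ⊕ agreements⁺ n (x ∘ suc) (y ∘ suc) (z ∘ suc) j ex ey ez)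
  (ℕ.≤-reflexive (interchange₃ (weight (agreement x y zero)) _ (weight (agreement x z zero)) _ (weight (agreement y z zero)) _))

-- Were the rank full, a basis of the family would be a basis of all columns, and rows agreeing on
-- it would coincide.
proper-rank : ∀ {d P Q k s} (K : Config d P Q) (g : Fin k → Fin Q) (Bg : Basis (cols (M K) ∘ g) s) →
  ∀ {a b} → a ≢ b → (∀ j → M K a (g j) ≡ M K b (g j)) → s < d
proper-rank {d} {s = s} K g Bg {a} {b} a≢b ag = go (extend (dual-∘ (M K) g (base Bg)))
  where
  go : (∃ λ t → Σ (Basis (cols (M K)) (t + s)) λ B → ∀ i → ix (base B) (t ↑ʳ i) ≡ g (ix (base Bg) i)) → s < d
  go (zero , B , e) = contradiction (rows-distinct K a b (agree-on-basis (M K) (λ j → j) B a b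
    (λ i → subst (λ c → M K a c ≡ M K b c) (sym (e i)) (ag (ix (base Bg) i))))) a≢b
  go (suc t , B , e) = subst (s <_) (basis-size B (rank K)) (s≤s (ℕ.m≤n+m s t))

-- The columns where the rows agree have rank at most `d`, so `2 + d` of them meet the threshold of
-- `large-hyperplane`.
agreeing-rows⇒large-hyperplane : ∀ {d P Q} (K : Config (suc d) P Q) {a b} → a ≢ b →
  2 + d ≤ count Q (agreement (M K a) (M K b)) →
  Σ (Basis (cols (M K)) (suc d)) λ B → 2 + d ≤ count Q (in-hyperplane B)
agreeing-rows⇒large-hyperplane {d} K {a} {b} a≢b le = go basis
  where
  E = enumerate (agreement (M K a) (M K b))
  go : (∃ λ s → Basis (cols (M K) ∘ elem E) s) → _
  go (s , Bg) = large-hyperplane (rank K) (elem E) (injective E) Bg s<d (ℕ.≤-trans (s≤s s<d) le)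
    where
    s<d : s < suc d
    s<d = proper-rank K (elem E) Bg a≢b (λ j → does-true (M K a (elem E j) Bool.≟ M K b (elem E j)) (sound E j))

three-rows⇒large-hyperplane : ∀ {e P Q} (K : Config (2 + e) P Q) {a b c} → a ≢ b → a ≢ c → b ≢ c →
  5 + 3 * e ≤ Q → Σ (Basis (cols (M K)) (2 + e)) λ B → 3 + e ≤ count Q (in-hyperplane B)
three-rows⇒large-hyperplane {e} {P} {Q} K {a} {b} {c} a≢b a≢c b≢c hQ = go (3 + e ℕ.≤? A) (3 + e ℕ.≤? B) (3 + e ℕ.≤? C)
  where
  A = count Q (agreement (M K a) (M K b))
  B = count Q (agreement (M K a) (M K c))
  C = count Q (agreement (M K b) (M K c))
  -- Three counts of at most `2 + e` add up to at most `6 + 3 * e`, but the zero column raises the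
  -- sum to at least `2 + Q ≥ 7 + 3 * e`.
  impossible : ∀ A B C → 2 + Q ≤ A + B + C → A ≤ 2 + e → B ≤ 2 + e → C ≤ 2 + e → ⊥
  impossible A B C h hA hB hC = overflow 0 (hQ ⊕ h ⊕ hA ⊕ hB ⊕ hC) (ring (A ∷ B ∷ C ∷ Q ∷ e ∷ []))
  go : Dec (3 + e ≤ A) → Dec (3 + e ≤ B) → Dec (3 + e ≤ C) → _
  go (yes h) _ _ = agreeing-rows⇒large-hyperplane K a≢b h
  go _ (yes h) _ = agreeing-rows⇒large-hyperplane K a≢c h
  go _ _ (yes h) = agreeing-rows⇒large-hyperplane K b≢c h
  go (no hA) (no hB) (no hC) = ⊥-elim (impossible A B C
    (let (z , zz) = zero-col K in agreements⁺ Q (M K a) (M K b) (M K c) z (zz a) (zz b) (zz c))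
    (ℕ.≤-pred (ℕ.≰⇒> hA)) (ℕ.≤-pred (ℕ.≰⇒> hB)) (ℕ.≤-pred (ℕ.≰⇒> hC)))

-- The rank is written `2 + e`, which keeps truncated subtraction out of the exponent and makes the
-- induction structural.
Bound : ℕ → Set
Bound e = ∀ {P Q} → Config (2 + e) P Q → 4 + e ≤ P → 4 + e ≤ Q → P + Q ≤ 3 * 2 ^ e + (4 + e)

-- The only case that calls on a smaller rank. As a separate statement it can be assumed while all
-- other cases are reduced to it or settled by counting.
LargeHyperplaneBound : ℕ → Set
LargeHyperplaneBound e = ∀ {P Q Q′} (K : Config (2 + e) P Q) → Q ≤ P → Split K Q′ → 3 + e ≤ Q′ →
  P + Q ≤ 3 * 2 ^ e + (4 + e)

three-distinct : ∀ {e P} → 4 + e ≤ P → Σ (Fin P) λ a → Σ (Fin P) λ b → Σ (Fin P) λ c → a ≢ b × a ≢ c × b ≢ c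
three-distinct (s≤s (s≤s (s≤s _))) = zero , suc zero , suc (suc zero) , (λ ()) , (λ ()) , (λ ())

ordered-bound : ∀ {e} → LargeHyperplaneBound e → ∀ {P Q} → Config (2 + e) P Q → 4 + e ≤ P → 4 + e ≤ Q → Q ≤ P →
  P + Q ≤ 3 * 2 ^ e + (4 + e)
ordered-bound {e} large {P} {Q} K hP hQ Q≤P = start (split K (rank K))
  where
  by-large : (Σ (Basis (cols (M K)) (2 + e)) λ B → 3 + e ≤ count Q (in-hyperplane B)) → P + Q ≤ 3 * 2 ^ e + (4 + e)
  by-large (B , h) = large K Q≤P (split K B) h
  module _ {Q′} (S : Split K Q′) (Q′≤ : Q′ ≤ 2 + e) where
    open Split S
    P′≤ : P′ ≤ 2 ^ (1 + e)
    P′≤ = rows≤2^rank sub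
    uniform : τ ≤ s → P + Q ≤ 3 * 2 ^ e + (4 + e)
    uniform hτ = subst (_≤ 3 * 2 ^ e + (4 + e)) (cong₂ _+_ rows-split cols-split)
      (uniform-bound s t P′≤ m≤2^t rank-split Q′≤ hτ (subst (4 + e ≤_) (sym cols-split) hQ))
    full : 2 + e ≤ s → Dec (5 + 3 * e ≤ Q) → P + Q ≤ 3 * 2 ^ e + (4 + e)
    full hs (yes h) = let (_ , _ , _ , ab , ac , bc) = three-distinct hP in by-large (three-rows⇒large-hyperplane K ab ac bc h)
    full hs (no h) = full-bound e P≤ Q≤P (ℕ.≤-pred (ℕ.≰⇒> h))
      where
      -- Full rank off the hyperplane leaves no further basis column to tell removed rows apart, so
      -- `m ≤ 1`.
      t≡0 : t ≡ 0
      t≡0 = ℕ.n≤0⇒n≡0 (ℕ.+-cancelʳ-≤ s t 0 (ℕ.≤-trans (ℕ.≤-reflexive rank-split) hs))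
      P≤ : P ≤ 2 ^ (1 + e) + 1
      P≤ = subst (_≤ 2 ^ (1 + e) + 1) rows-split (P′≤ ⊕ subst (λ t → m ≤ 2 ^ t) t≡0 m≤2^t)
    thin : Dec (τ ≤ s) → Dec (s < 2 + e) → P + Q ≤ 3 * 2 ^ e + (4 + e)
    thin (yes h) _ = uniform h
    -- Since `off` has `suc τ` members, `τ > s` is exactly the threshold `2 + s ≤ suc τ`.
    thin (no h) (yes s<) = by-large (large-hyperplane (rank K) off off-injective off-basis s< (s≤s (ℕ.≰⇒> h)))
    thin (no h) (no s≮) = full (ℕ.≮⇒≥ s≮) (5 + 3 * e ℕ.≤? Q)
  start : ∀ {Q′} → Split K Q′ → P + Q ≤ 3 * 2 ^ e + (4 + e)
  start {Q′} S with 3 + e ℕ.≤? Q′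
  ... | yes h = large K Q≤P S h
  ... | no h = thin S (ℕ.≤-pred (ℕ.≰⇒> h)) (Split.τ S ℕ.≤? Split.s S) (Split.s S ℕ.<? 2 + e)

symmetric-bound : ∀ {e} → LargeHyperplaneBound e → Bound e
symmetric-bound {e} large {P} {Q} K hP hQ with ℕ.≤-total Q P
... | inj₁ Q≤P = ordered-bound large K hP hQ Q≤P
... | inj₂ P≤Q = subst (_≤ 3 * 2 ^ e + (4 + e)) (ℕ.+-comm Q P) (ordered-bound large (transpose K) hQ hP P≤Q)

large-hyperplane-bound : ∀ e → LargeHyperplaneBound e

bound : ∀ e → Bound e
bound e = symmetric-bound (large-hyperplane-bound e)

-- The cut has rank 1, hence at most two distinct columns, against `3 ≤ Q′`.
large-hyperplane-bound zero K Q≤P S h =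
  contradiction (ℕ.≤-trans h (rows≤2^rank (transpose (Split.sub S)))) (ℕ.<-irrefl refl)
large-hyperplane-bound (suc f) {P} {Q} {Q′} K Q≤P S h =
  subst (_≤ 3 * 2 ^ (1 + f) + (5 + f)) (cong₂ _+_ rows-split cols-split)
    (hyperplane-bound h (ℕ.≤-trans (ℕ.≤-reflexive cols-split) (ℕ.≤-trans Q≤P (ℕ.≤-reflexive (sym rows-split))))
      (rows≤2^rank (transpose sub)) m≤P′ (λ hP → bound f sub hP h) s t rank-split m≤2^t τ<2^s)
  where open Split S

-- Bipartite graphs

border : ∀ {p q} → (Fin p → Fin q → Bool) → Fin (suc p) → Fin (suc q) → Bool
border N zero    _       = false
border N (suc a) zero    = false
border N (suc a) (suc j) = N a j

border-basis : ∀ {p q d} {N : Fin p → Fin q → Bool} → Basis (cols N) d → Basis (cols (border N)) d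
border-basis {p} {q} {d} {N} B = record
  { base = record { ix = suc ∘ ix D ; φ = φ′ ; dual = λ i j → trans (dot-suc i (ix D j)) (dual D i j) }
  ; spans = spans′ }
  where
  D = base B
  φ′ : Fin d → Fin (suc p) → ℚ
  φ′ i zero    = 0ℚ
  φ′ i (suc x) = φ D i x
  dot-suc : ∀ i j → dot (φ′ i) (cols (border N) (suc j)) ≡ coef D i j
  dot-suc i j = ℚ.+-identityˡ (coef D i j)
  dot-zero-col : ∀ i → dot (φ′ i) (cols (border N) zero) ≡ 0ℚ
  dot-zero-col i = dot-zero (φ′ i) {cols (border N) zero} λ { zero → refl ; (suc x) → refl }
  spans′ : ∀ j x → cols (border N) j x ≡ Σℚ d (λ i → dot (φ′ i) (cols (border N) j) *ℚ cols (border N) (suc (ix D i)) x)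
  spans′ j zero = sym (Σ-zero d (λ i → ℚ.*-zeroʳ (dot (φ′ i) (cols (border N) j))))
  spans′ zero (suc x) = sym (Σ-zero d (λ i → trans
    (cong (_*ℚ ⟦ N x (ix D i) ⟧) (dot-zero-col i)) (ℚ.*-zeroˡ ⟦ N x (ix D i) ⟧)))
  spans′ (suc j) (suc x) = trans (spans B j x)
    (Σ-cong d (λ i → cong (_*ℚ ⟦ N x (ix D i) ⟧) (sym (dot-suc i j))))

Σ-↑ : ∀ m n (f : Fin (m + n) → ℚ) →
  Σℚ (m + n) f ≡ Σℚ m (λ i → f (i ↑ˡ n)) +ℚ Σℚ n (λ i → f (m ↑ʳ i))
Σ-↑ zero    n f = sym (ℚ.+-identityˡ (Σℚ n f))
Σ-↑ (suc m) n f = trans (cong (f zero +ℚ_) (Σ-↑ m n (f ∘ suc)))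
  (sym (ℚ.+-assoc (f zero) (Σℚ m (λ i → f (suc (i ↑ˡ n)))) (Σℚ n (λ i → f (suc (m ↑ʳ i))))))

module Bipartitioned {n : ℕ} (G : Graph n) (col : Fin n → Bool) (bip : IsBipartition G col) where

  inX : Fin n → Bool
  inX v = if col v then false else true

  EX : Enumeration inX (sizeX col)
  EX = enumerate inX

  EY : Enumeration col (sizeY col)
  EY = enumerate col

  x : Fin (sizeX col) → Fin n
  x = elem EX

  y : Fin (sizeY col) → Fin n
  y = elem EY

  col-x : ∀ a → col (x a) ≡ false
  col-x a with col (x a) | sound EX a
  ... | false | _ = refl

  col-y : ∀ j → col (y j) ≡ true
  col-y = sound EY

  same-colour : ∀ {u v} → col u ≡ col v → adj G u v ≡ false
  same-colour {u} {v} e with adj G u v in eq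
  ... | false = refl
  ... | true  = contradiction e (bip u v eq)

  data Side : Fin n → Set where
    left  : ∀ a → Side (x a)
    right : ∀ j → Side (y j)

  side : ∀ v → Side v
  side v with col v in eq
  ... | true  = subst Side (elem-index EY v eq) (right (index EY v eq))
  ... | false = subst Side (elem-index EX v h) (left (index EX v h))
    where
    h : inX v ≡ true
    h = cong (λ b → if b then false else true) eq

  N : Fin (sizeX col) → Fin (sizeY col) → Bool
  N a j = adj G (x a) (y j)

  sizes : sizeX col + sizeY col ≡ n
  sizes = trans (ℕ.+-comm (sizeX col) (sizeY col)) (count-complement n col inX (λ v → if≡not (col v)))
    where
    if≡not : ∀ b → (if b then false else true) ≡ not b
    if≡not true  = refl
    if≡not false = refl

  -- The rank of a bipartite adjacency matrix

  module _ {d : ℕ} (B : Basis (cols N) d) where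

    Bᵀ : Basis (λ a j → ⟦ N a j ⟧) d
    Bᵀ = transpose-basis B

    A : Fin n → Fin n → ℚ
    A = adjMatrix G

    A-xx : ∀ a b → A (x a) (x b) ≡ 0ℚ
    A-xx a b = cong ⟦_⟧ (same-colour (trans (col-x a) (sym (col-x b))))

    A-yy : ∀ i j → A (y i) (y j) ≡ 0ℚ
    A-yy i j = cong ⟦_⟧ (same-colour (trans (col-y i) (sym (col-y j))))

    A-yx : ∀ j a → A (y j) (x a) ≡ ⟦ N a j ⟧
    A-yx j a = cong ⟦_⟧ (adj-sym G (y j) (x a))

    -- The adjacency matrix has the off-diagonal blocks `N` and its transpose. A row basis of `N`
    -- and a column basis of `N` together index a row basis of it.
    F : Fin (d + d) → Fin n
    F = [ x ∘ ix (base Bᵀ) , y ∘ ix (base B) ]′ ∘ splitAt d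

    F-↑ˡ : ∀ i → F (i ↑ˡ d) ≡ x (ix (base Bᵀ) i)
    F-↑ˡ i = cong [ x ∘ ix (base Bᵀ) , y ∘ ix (base B) ]′ (Fin.splitAt-↑ˡ d i d)

    F-↑ʳ : ∀ i → F (d ↑ʳ i) ≡ y (ix (base B) i)
    F-↑ʳ i = cong [ x ∘ ix (base Bᵀ) , y ∘ ix (base B) ]′ (Fin.splitAt-↑ʳ d d i)

    comb-F : ∀ c v → comb c (A ∘ F) v ≡
      comb (c ∘ (_↑ˡ d)) (A ∘ x ∘ ix (base Bᵀ)) v +ℚ comb (c ∘ (d ↑ʳ_)) (A ∘ y ∘ ix (base B)) v
    comb-F c v = trans (Σ-↑ d d (λ i → c i *ℚ A (F i) v)) (cong₂ _+ℚ_
      (Σ-cong d (λ i → cong (λ u → c (i ↑ˡ d) *ℚ A u v) (F-↑ˡ i)))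
      (Σ-cong d (λ i → cong (λ u → c (d ↑ʳ i) *ℚ A u v) (F-↑ʳ i))))

    comb-F-y : ∀ c j → comb c (A ∘ F) (y j) ≡ comb (c ∘ (_↑ˡ d)) (λ i j → ⟦ N (ix (base Bᵀ) i) j ⟧) j
    comb-F-y c j = trans (comb-F c (y j)) (trans
      (cong (comb (c ∘ (_↑ˡ d)) (A ∘ x ∘ ix (base Bᵀ)) (y j) +ℚ_)
        (Σ-zero d (λ i → trans (cong (c (d ↑ʳ i) *ℚ_) (A-yy (ix (base B) i) j)) (ℚ.*-zeroʳ (c (d ↑ʳ i))))))
      (ℚ.+-identityʳ (comb (c ∘ (_↑ˡ d)) (A ∘ x ∘ ix (base Bᵀ)) (y j))))

    comb-F-x : ∀ c a → comb c (A ∘ F) (x a) ≡ comb (c ∘ (d ↑ʳ_)) (cols N ∘ ix (base B)) a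
    comb-F-x c a = trans (comb-F c (x a)) (trans
      (cong₂ _+ℚ_
        (Σ-zero d (λ i → trans (cong (c (i ↑ˡ d) *ℚ_) (A-xx (ix (base Bᵀ) i) a)) (ℚ.*-zeroʳ (c (i ↑ˡ d)))))
        (Σ-cong d (λ i → cong (c (d ↑ʳ i) *ℚ_) (A-yx (ix (base B) i) a))))
      (ℚ.+-identityˡ (comb (c ∘ (d ↑ʳ_)) (cols N ∘ ix (base B)) a)))

    -- Evaluated on Y, a relation involves only the rows from X, and vice versa, so it splits into
    -- one relation for each block.
    F-independent : RowsIndependent A F
    F-independent c z i = subst (λ i → c i ≡ 0ℚ) (Fin.join-splitAt d d i) (go (splitAt d i))
      where
      go : ∀ s → c (Fin.join d d s) ≡ 0ℚ
      go (inj₁ i) = independent (base Bᵀ) (c ∘ (_↑ˡ d)) (λ j → trans (sym (comb-F-y c j)) (z (y j))) i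
      go (inj₂ i) = independent (base B) (c ∘ (d ↑ʳ_)) (λ a → trans (sym (comb-F-x c a)) (z (x a))) i

    _∥_ : (Fin d → ℚ) → (Fin d → ℚ) → Fin (d + d) → ℚ
    (f ∥ g) i = [ f , g ]′ (splitAt d i)

    ∥-↑ˡ : ∀ f g i → (f ∥ g) (i ↑ˡ d) ≡ f i
    ∥-↑ˡ f g i = cong [ f , g ]′ (Fin.splitAt-↑ˡ d i d)

    ∥-↑ʳ : ∀ f g i → (f ∥ g) (d ↑ʳ i) ≡ g i
    ∥-↑ʳ f g i = cong [ f , g ]′ (Fin.splitAt-↑ʳ d d i)

    comb-∥-y : ∀ f g j → comb (f ∥ g) (A ∘ F) (y j) ≡ comb f (λ i j → ⟦ N (ix (base Bᵀ) i) j ⟧) j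
    comb-∥-y f g j = trans (comb-F-y (f ∥ g) j) (Σ-cong d (λ i → cong (_*ℚ ⟦ N (ix (base Bᵀ) i) j ⟧) (∥-↑ˡ f g i)))

    comb-∥-x : ∀ f g a → comb (f ∥ g) (A ∘ F) (x a) ≡ comb g (cols N ∘ ix (base B)) a
    comb-∥-x f g a = trans (comb-F-x (f ∥ g) a) (Σ-cong d (λ i → cong (_*ℚ ⟦ N a (ix (base B) i) ⟧) (∥-↑ʳ f g i)))

    comb-0 : ∀ {p} (w : Fin d → Fin p → ℚ) z → comb (λ _ → 0ℚ) w z ≡ 0ℚ
    comb-0 w z = Σ-zero d (λ i → ℚ.*-zeroˡ (w i z))

    expand : ∀ {u} → Side u → ∃ λ c → ∀ v → A u v ≡ comb c (A ∘ F) v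
    expand (left a) = f ∥ (λ _ → 0ℚ) , λ v → go (side v)
      where
      f : Fin d → ℚ
      f i = coef (base Bᵀ) i a
      go : ∀ {v} → Side v → A (x a) v ≡ comb (f ∥ (λ _ → 0ℚ)) (A ∘ F) v
      go (left b)  = trans (A-xx a b) (sym (trans (comb-∥-x f (λ _ → 0ℚ) b) (comb-0 (cols N ∘ ix (base B)) b)))
      go (right j) = trans (spans Bᵀ a j) (sym (comb-∥-y f (λ _ → 0ℚ) j))
    expand (right j) = (λ _ → 0ℚ) ∥ g , λ v → go (side v)
      where
      g : Fin d → ℚ
      g i = coef (base B) i j
      go : ∀ {v} → Side v → A (y j) v ≡ comb ((λ _ → 0ℚ) ∥ g) (A ∘ F) v
      go (left a)  = trans (A-yx j a) (trans (spans B j a) (sym (comb-∥-x (λ _ → 0ℚ) g a)))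
      go (right k) = trans (A-yy j k) (sym (trans (comb-∥-y (λ _ → 0ℚ) g k)
        (comb-0 (λ i j → ⟦ N (ix (base Bᵀ) i) j ⟧) k)))

    graph-rank : ∀ {r} → GraphRank G r → r ≡ d + d
    graph-rank ((f , ind) , maximal) = ℕ.≤-antisym
      (independent⇒≤ (A ∘ f) (λ i → proj₁ (expand (side (f i)))) (A ∘ F) ind (λ i → proj₂ (expand (side (f i)))))
      (maximal (d + d) F F-independent)

    -- The configuration of a reduced bipartite graph

    module _ (red : Reduced G) where

      has-opposite-neighbour : ∀ u → ¬ (∀ w → col w ≢ col u → adj G u w ≡ false)
      has-opposite-neighbour u h with proj₁ red u
      ... | w , uw = contradiction (trans (sym uw) (h w (λ e → bip u w uw (sym e)))) λ ()

      -- Neither vertex has neighbours in their common class, so their neighbourhoods need comparing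
      -- only on the other one.
      opposite-neighbours-determine : ∀ u v → col u ≡ col v →
        (∀ w → col w ≢ col u → adj G u w ≡ adj G v w) → u ≡ v
      opposite-neighbours-determine u v e h = proj₂ red u v agree
        where
        agree : ∀ w → adj G u w ≡ adj G v w
        agree w with col w Bool.≟ col u
        ... | no ne  = h w ne
        ... | yes eq = trans (same-colour (sym eq)) (sym (same-colour (trans (sym e) (sym eq))))

      on-Y : ∀ {a} (f g : Fin n → Bool) → (∀ j → f (y j) ≡ g (y j)) → ∀ w → col w ≢ col (x a) → f w ≡ g w
      on-Y {a} f g h w ne with side w
      ... | right j = h j
      ... | left b  = contradiction (trans (col-x b) (sym (col-x a))) ne

      on-X : ∀ {j} (f g : Fin n → Bool) → (∀ a → f (x a) ≡ g (x a)) → ∀ w → col w ≢ col (y j) → f w ≡ g w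
      on-X {j} f g h w ne with side w
      ... | left a  = h a
      ... | right k = contradiction (trans (col-y k) (sym (col-y j))) ne

      nonzero-row : ∀ a → ¬ (∀ j → N a j ≡ false)
      nonzero-row a h = has-opposite-neighbour (x a) (on-Y {a} (adj G (x a)) (λ _ → false) h)

      nonzero-col : ∀ j → ¬ (∀ a → N a j ≡ false)
      nonzero-col j h = has-opposite-neighbour (y j)
        (on-X {j} (adj G (y j)) (λ _ → false) (λ a → trans (adj-sym G (y j) (x a)) (h a)))

      -- Old rows and columns are distinct because no two vertices have equal neighbourhoods, and
      -- they differ from the adjoined zero ones because no vertex is isolated.
      config : Config d (suc (sizeX col)) (suc (sizeY col))
      config = record
        { M = border N ; rows-distinct = rd ; cols-distinct = cd
        ; zero-row = zero , (λ _ → refl) ; zero-col = zero , λ { zero → refl ; (suc _) → refl }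
        ; rank = border-basis B }
        where
        rd : ∀ a b → (∀ j → border N a j ≡ border N b j) → a ≡ b
        rd zero    zero    h = refl
        rd zero    (suc b) h = contradiction (λ j → sym (h (suc j))) (nonzero-row b)
        rd (suc a) zero    h = contradiction (λ j → h (suc j)) (nonzero-row a)
        rd (suc a) (suc b) h = cong suc (injective EX (opposite-neighbours-determine (x a) (x b)
          (trans (col-x a) (sym (col-x b))) (on-Y {a} (adj G (x a)) (adj G (x b)) (h ∘ suc))))
        cd : ∀ i j → (∀ a → border N a i ≡ border N a j) → i ≡ j
        cd zero    zero    h = refl
        cd zero    (suc j) h = contradiction (λ a → sym (h (suc a))) (nonzero-col j)
        cd (suc i) zero    h = contradiction (λ a → h (suc a)) (nonzero-col i)
        cd (suc i) (suc j) h = cong suc (injective EY (opposite-neighbours-determine (y i) (y j)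
          (trans (col-y i) (sym (col-y j))) (on-X {i} (adj G (y i)) (adj G (y j))
            (λ a → trans (adj-sym G (y i) (x a)) (trans (h (suc a)) (adj-sym G (x a) (y j)))))))

half-double : ∀ d → (d + d) / 2 ≡ d
half-double d = trans (cong (_/ 2) (double d)) (m*n/n≡m d 2)
  where
  double : ∀ d → d + d ≡ d * 2
  double d = ring (d ∷ [])

-- If both sizes exceeded `d`, the bordered matrix would have at least `d + 2` rows and columns.
-- Then `bound`, less the two adjoined lines, contradicts the assumed order.
min-size : ∀ d p q → 3 ≤ d → d ≤ p → d ≤ q → Config d (suc p) (suc q) →
  3 * 2 ^ (d ∸ 2) + d < p + q → p ⊓ q ≡ d
min-size (suc (suc e)) p q (s≤s (s≤s _)) d≤p d≤q K h with ℕ.m≤n⇒m<n∨m≡n d≤p | ℕ.m≤n⇒m<n∨m≡n d≤q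
... | inj₂ refl | _         = ℕ.m≤n⇒m⊓n≡m d≤q
... | inj₁ _    | inj₂ refl = ℕ.m≥n⇒m⊓n≡n d≤p
... | inj₁ d<p  | inj₁ d<q  = ⊥-elim (go (3 * 2 ^ e) h (bound e K (s≤s d<p) (s≤s d<q)))
  where
  go : ∀ c → c + (2 + e) < p + q → suc p + suc q ≤ c + (4 + e) → ⊥
  go c h h′ = overflow 0 (h ⊕ h′) (ring (c ∷ e ∷ p ∷ q ∷ []))

theorem3p1 : (n : ℕ) (G : Graph n) (r : ℕ) (col : Fin n → Bool) →
    Reduced G → IsBipartition G col → GraphRank G r → 6 ≤ r →
    3 * 2 ^ (r / 2 ∸ 2) + r / 2 < n →
    sizeX col ⊓ sizeY col ≡ r / 2
theorem3p1 n G r col red bip rk 6≤r h = go basis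
  where
  open Bipartitioned G col bip
  go : (∃ λ d → Basis (cols N) d) → sizeX col ⊓ sizeY col ≡ r / 2
  go (d , B) = trans
    (min-size d (sizeX col) (sizeY col) 3≤d (dual-size≤dim (base B)) (dual-size≤dim (base (transpose-basis B)))
      (config B red) (subst (λ d → 3 * 2 ^ (d ∸ 2) + d < sizeX col + sizeY col) r/2≡d
        (subst (3 * 2 ^ (r / 2 ∸ 2) + r / 2 <_) (sym sizes) h)))
    (sym r/2≡d)
    where
    r≡ : r ≡ d + d
    r≡ = graph-rank B rk
    r/2≡d : r / 2 ≡ d
    r/2≡d = trans (cong (_/ 2) r≡) (half-double d)
    3≤d : 3 ≤ d
    3≤d = subst (3 ≤_) r/2≡d (/-monoˡ-≤ {6} {r} 2 6≤r)
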